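{- Let $v$ be a positive integer with $v\equiv 0$ or $2\pmod 3$ and $v\ne 3$, and let $H$ be a Hadamard matrix of order $v^2$. (i) There exists a block-symmetric $\mathcal{C}^3_3\big(v^3,\ v^4(v^2-1)/2,\ v^4(v^2-2)/4\big)$-cube. (ii) If $H$ is regular, there exists a block-symmetric $\mathcal{C}^3_3\big(v^3,\ v^3(v^3-1)/2,\ v^3(v^3-2)/4\big)$-cube.
   Context: A $w\times w\times w$ array is a function on $\{1,\dots,w\}^3$. A layer is obtained by fixing one of the three coordinates; two layers are parallel if they fix the same coordinate, to different values; their scalar product is the sum over all positions of the product of corresponding entries. $\mathcal{C}^3_3(w,k,\lambda)$ is the set of $w\times w\times w$ arrays over $\{0,1\}$ such that every layer (in each of the three directions) contains exactly $k$ ones and every two parallel layers have scalar product $\lambda$; its elements are called $\mathcal{C}^3_3(w,k,\lambda)$-cubes. A Hadamard matrix of order $n$ is an $n\times n$ matrix over $\{1,-1\}$ whose distinct rows are orthogonal and whose distinct columns are orthogonal; it is regular if all its row sums and column sums are equal to each other. A cube $A\in\mathcal{C}^3_3(v^3,k,\lambda)$ of order $v^3$ is block-symmetric if, partitioning $\{1,\dots,v^3\}$ into $v$ consecutive intervals of length $v^2$ and letting $A_{ij\ell}$ ($i,j,\ell\in\{1,\dots,v\}$) be the $v^2\times v^2\times v^2$ array $A_{ij\ell}(a,b,c)=A\big(v^2(i-1)+a,\ v^2(j-1)+b,\ v^2(\ell-1)+c\big)$, one has (1) $A_{ij\ell}=A_{j\ell i}=A_{\ell ij}$ for distinct $i,j,\ell\in\{1,\dots,v\}$;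 (2) $A_{iij}=A_{jji}$, $A_{iji}=A_{jij}$, $A_{ijj}=A_{jii}$ for all $i,j\in\{1,\dots,v\}$. -}

module Defs where

import Algebra.Properties.Monoid.Sum
open import Data.Bool.Base using (if_then_else_)
open import Data.Fin.Base using (Fin; toℕ; combine)
open import Data.Fin.Patterns using (0F; 1F; 2F)
open import Data.Fin.Properties using (_≟_)
open import Data.Integer.Base as ℤ using (ℤ; 0ℤ; 1ℤ; -1ℤ)
import Data.Integer.Properties as ℤ
open import Data.Nat.Base using (ℕ; _+_; _*_; _^_)
import Data.Nat.Properties as ℕ
open import Data.Product.Base using (∃-syntax; _×_)
open import Data.Sum.Base using (_⊎_)
open import Level using (Level)
open import Relation.Binary.PropositionalEquality.Core using (_≡_; _≢_)
open import Relation.Nullary.Decidable.Core using (does)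

open Algebra.Properties.Monoid.Sum ℕ.+-0-monoid using () renaming (sum to sumℕ) public
open Algebra.Properties.Monoid.Sum ℤ.+-0-monoid using () renaming (sum to sumℤ) public

private variable
  a : Level
  X : Set a
  w n v : ℕ

Matrix : Set a → ℕ → Set a
Matrix X n = Fin n → Fin n → X

Array³ : Set a → ℕ → Set a
Array³ X w = Fin w → Fin w → Fin w → X

-- layer A d x fixes the coordinate in direction d to the value x.
layer : Array³ X w → Fin 3 → Fin w → Matrix X w
layer A 0F x = λ y z → A x y z
layer A 1F y = λ x z → A x y z
layer A 2F z = λ x y → A x y z

#ones : Matrix (Fin 2) w → ℕ
#ones L = sumℕ λ y → sumℕ λ z → if does (L y z ≟ 1F) then 1 else 0

scalarProduct : Matrix (Fin 2) w → Matrix (Fin 2) w → ℕ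
scalarProduct L M = sumℕ λ y → sumℕ λ z → toℕ (L y z) * toℕ (M y z)

-- Membership in 𝒞³₃(w,k,λ), with λ written as l.
record IsCube (w k l : ℕ) (A : Array³ (Fin 2) w) : Set where
  field
    ones     : ∀ d x → #ones (layer A d x) ≡ k
    parallel : ∀ d x y → x ≢ y → scalarProduct (layer A d x) (layer A d y) ≡ l

record IsHadamard (n : ℕ) (H : Matrix ℤ n) : Set where
  field
    entries : ∀ i j → H i j ≡ 1ℤ ⊎ H i j ≡ -1ℤ
    rows    : ∀ i j → i ≢ j → sumℤ (λ k → H i k ℤ.* H j k) ≡ 0ℤ
    columns : ∀ i j → i ≢ j → sumℤ (λ k → H k i ℤ.* H k j) ≡ 0ℤ

IsRegular : Matrix ℤ n → Set
IsRegular H = ∃[ s ] (∀ i → sumℤ (λ j → H i j) ≡ s) × (∀ j → sumℤ (λ i → H i j) ≡ s)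

-- combine i a : Fin (v * v ^ 2) has value v² · i + a, and v ^ 3 reduces to
-- v * v ^ 2; indices start at 0 instead of 1.
block : Array³ X (v ^ 3) → Fin v → Fin v → Fin v → Array³ X (v ^ 2)
block A i j l a b c = A (combine i a) (combine j b) (combine l c)

_≐_ : Array³ X w → Array³ X w → Set _
A ≐ B = ∀ a b c → A a b c ≡ B a b c

infix 4 _≐_

record IsBlockSymmetric (v : ℕ) (A : Array³ (Fin 2) (v ^ 3)) : Set where
  private
    B : Fin v → Fin v → Fin v → Array³ (Fin 2) (v ^ 2)
    B = block {v = v} A
  field
    cyclic : ∀ i j l → i ≢ j → j ≢ l → i ≢ l →
             (B i j l ≐ B j l i) × (B j l i ≐ B l i j)
    iij    : ∀ i j → B i i j ≐ B j j i
    iji    : ∀ i j → B i j i ≐ B j i j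
    ijj    : ∀ i j → B i j j ≐ B j i i

-- When k and l are written with the truncating _/_ as halves and quarters such as
-- v⁴(v²−1)/2 and v⁴(v²−2)/4, these are exact for even v; v > 1 is even whenever a
-- Hadamard matrix of order v² exists.
BlockSymmetricCube : (v k l : ℕ) → Set
BlockSymmetricCube v k l = ∃[ A ] IsCube (v ^ 3) k l A × IsBlockSymmetric v A

{-# OPTIONS --safe #-}
-- Let hₚ be the rows of a Hadamard matrix h of order v², and let p(i,j,l) ∈ {0,…,v²−1} be a label
-- for each (i,j,l) such that every layer of p is a bijection with the set of labels.  The array of
-- signs whose block (i,j,l) is the rank-one array hₚ ⊗ hₚ ⊗ hₚ with p = p(i,j,l) has pairwise
-- orthogonal parallel layers: in different slices of blocks because the rows hₚ are orthogonal, and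
-- within one slice because the columns of h are.  Its layer sums Σₚ hₚ(a) (Σ hₚ)² are v⁴ when row 0
-- of h is constantly 1, and v³ when all line sums of h equal v.
--
-- Block symmetry requires p to be invariant under the cyclic shift of distinct indices and under
-- exchanging the two values of an index triple with two of them.  The positions with a given label
-- then form a partition of the v indices into cyclically oriented triples, pairs of three types and
-- singletons.  Such partitions come from Baranyai's theorem, since v is even: if 3 ∣ v, take a
-- factorisation of all triples once for each orientation, a factorisation of all pairs once for each
-- type, and the partition into singletons; if 3 ∣ v + 1, take the factorisation of all triples of
-- v + 1 points, where a triple containing the extra point stands for a pair, so that only one type
-- of pairs remains.
--
-- Baranyai's theorem is proved by adding one point at a time (Brouwer–Schrijver).  The parts that
-- receive the new point are a perfect matching in a regular bipartite multigraph, which exists by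
-- Hall's theorem.
module Submission where

open import Defs
open import Data.Bool.Base using (Bool; true; false; not; _xor_; _∨_; _∧_; if_then_else_)
import Data.Bool.Properties as Bool
open import Data.Fin.Base using (Fin; zero; suc; combine; remQuot; toℕ; _↑ˡ_; _↑ʳ_)
open import Data.Fin.Patterns using (0F; 1F; 2F)
open import Data.Fin.Properties as Fin using (any?; remQuot-combine; combine-remQuot; 2↔Bool; *↔×; +↔⊎)
open import Data.Fin.Subset using (Subset; Side; inside; outside; ∣_∣; _∪_; _∩_; _∈_; _∉_; _⊆_; ⊥; ⁅_⁆)
import Data.Fin.Subset.Properties as Subset
open import Data.Integer.Base as ℤ using (ℤ; 0ℤ; 1ℤ; -1ℤ)
import Data.Integer.Properties as ℤ
import Data.Integer.Tactic.RingSolver as ℤSolver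
open import Data.Nat.Base using (ℕ; zero; suc; pred; _+_; _*_; _∸_; _^_; _/_; _%_; _≤_; _<_;
  z≤n; s≤s; z<s; s<s; NonZero)
open import Data.Nat.Combinatorics using (_C_; nCk+nC[k+1]≡[n+1]C[k+1]; k>n⇒nCk≡0; nC1≡n)
open import Data.Nat.DivMod using (m*n/n≡m; m≡m%n+[m/n]*n)
open import Data.Nat.Divisibility using (_∣_; divides)
open import Data.Nat.Primality using (euclidsLemma; prime[2])
import Data.Nat.Properties as ℕ
import Data.Nat.Tactic.RingSolver as ℕSolver
open import Data.Product.Base as Product using (_×_; _,_; proj₁; proj₂; ∃-syntax; uncurry)
open import Data.Product.Function.NonDependent.Propositional using (_×-↔_)
open import Data.Product.Properties using (,-injective)
open import Data.Sum.Base as Sum using (_⊎_; inj₁; inj₂)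
open import Data.Sum.Function.Propositional using (_⊎-↔_)
open import Data.Sum.Properties using (inj₁-injective; inj₂-injective)
open import Data.Unit.Base using (⊤; tt)
open import Data.Vec.Base using (Vec; []; _∷_; lookup; map; tabulate; here; there)
open import Data.Vec.Functional using (updateAt)
open import Data.Vec.Properties using (lookup∘tabulate; ≡-dec; lookup⇒[]=; []=⇒lookup)
open import Function.Base using (_∘_; id; case_of_)
open import Function.Bundles using (Inverse; _↔_; Injection)
open import Function.Properties.Inverse using (↔-refl; ↔-sym; ↔-trans; Inverse⇒Injection)
open import Level using (Level)
open import Relation.Binary.Definitions using (DecidableEquality; tri<; tri≈; tri>)
open import Relation.Binary.PropositionalEquality using
  (_≡_; _≢_; refl; sym; trans; cong; cong₂; subst; subst₂; module ≡-Reasoning)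
open import Relation.Nullary.Decidable using (Dec; yes; no; does; _×-dec_; dec-true; dec-false)
open import Relation.Nullary.Negation using (contradiction)

open import Algebra.Properties.CommutativeSemigroup ℕ.+-commutativeSemigroup using ()
  renaming (interchange to +-interchange)
open import Algebra.Properties.CommutativeSemigroup ℕ.*-commutativeSemigroup using ()
  renaming (x∙yz≈y∙xz to x*yz≡y*xz)
import Algebra.Properties.CommutativeSemigroup ℤ.*-commutativeSemigroup as ℤ*
import Algebra.Properties.CommutativeMonoid.Sum ℕ.+-0-commutativeMonoid as ℕ∑
import Algebra.Properties.Semiring.Sum ℕ.+-*-semiring as ℕ∑*
import Algebra.Properties.CommutativeMonoid.Sum ℤ.+-0-commutativeMonoid as ℤ∑
import Algebra.Properties.Semiring.Sum ℤ.+-*-semiring as ℤ∑*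

private variable
  a : Level
  X Y : Set a
  k m n ℓ M N v : ℕ

-- Hall's theorem with capacities

weight : (Fin n → ℕ) → Subset n → ℕ
weight c []      = 0
weight c (b ∷ S) = (if b then c zero else 0) + weight (c ∘ suc) S

∣p∣≡weight : (S : Subset n) → ∣ S ∣ ≡ weight (λ _ → 1) S
∣p∣≡weight []            = refl
∣p∣≡weight (inside  ∷ S) = cong suc (∣p∣≡weight S)
∣p∣≡weight (outside ∷ S) = ∣p∣≡weight S

-- Modularity of capacities, on which the uncrossing of tight sets rests.
weight-∪∩ : (c : Fin n → ℕ) (S T : Subset n) →
            weight c (S ∪ T) + weight c (S ∩ T) ≡ weight c S + weight c T
weight-∪∩ c []      []      = refl
weight-∪∩ c (x ∷ S) (y ∷ T) = trans (+-interchange (χ (x ∨ y)) _ (χ (x ∧ y)) _)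
  (trans (cong₂ _+_ (sides x y) (weight-∪∩ (c ∘ suc) S T)) (+-interchange (χ x) (χ y) _ _))
  where
  χ : Side → ℕ
  χ b = if b then c zero else 0
  sides : ∀ x y → χ (x ∨ y) + χ (x ∧ y) ≡ χ x + χ y
  sides true  true  = refl
  sides true  false = refl
  sides false y     = ℕ.+-identityʳ (χ y)

∣∪∣+∣∩∣ : (S T : Subset n) → ∣ S ∪ T ∣ + ∣ S ∩ T ∣ ≡ ∣ S ∣ + ∣ T ∣
∣∪∣+∣∩∣ S T rewrite ∣p∣≡weight (S ∪ T) | ∣p∣≡weight (S ∩ T) | ∣p∣≡weight S | ∣p∣≡weight T =
  weight-∪∩ _ S T

-- Points of capacity zero are exempt from the inclusion because the tight sets in `extendible`
-- cover only those points of `B` that still have capacity.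
weight-mono : (c : Fin n → ℕ) (S T : Subset n) → (∀ {i} → i ∈ S → 0 < c i → i ∈ T) →
              weight c S ≤ weight c T
weight-mono c []            []            S⊆T = z≤n
weight-mono c (outside ∷ S) (t ∷ T)       S⊆T = ℕ.≤-trans
  (weight-mono (c ∘ suc) S T λ i∈S 0<c → Subset.drop-there (S⊆T (there i∈S) 0<c)) (ℕ.m≤n+m _ _)
weight-mono c (inside ∷ S)  (inside ∷ T)  S⊆T = ℕ.+-monoʳ-≤ (c zero)
  (weight-mono (c ∘ suc) S T λ i∈S 0<c → Subset.drop-there (S⊆T (there i∈S) 0<c))
weight-mono c (inside ∷ S)  (outside ∷ T) S⊆T with c zero | S⊆T {zero} here
... | zero  | _ = weight-mono (c ∘ suc) S T λ i∈S 0<c → Subset.drop-there (S⊆T (there i∈S) 0<c)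
... | suc _ | 0∈T = contradiction (0∈T z<s) λ ()

-- Used to see that a set which violates Hall's condition only after one capacity is lowered was
-- tight before and has the lowered point among its neighbours.
weight-updateAt : (c : Fin n → ℕ) (i : Fin n) (S : Subset n) → 0 < c i →
  (i ∈ S × weight c S ≡ suc (weight (updateAt c i pred) S)) ⊎ weight c S ≡ weight (updateAt c i pred) S
weight-updateAt c zero (inside ∷ S) 0<c with c zero
... | suc _ = inj₁ (here , refl)
weight-updateAt c zero (outside ∷ S) 0<c = inj₂ refl
weight-updateAt c (suc i) (b ∷ S) 0<c with weight-updateAt (c ∘ suc) i S 0<c
... | inj₁ (i∈S , eq) = inj₁ (there i∈S , trans (cong ((if b then c zero else 0) +_) eq) (ℕ.+-suc _ _))
... | inj₂ eq         = inj₂ (cong ((if b then c zero else 0) +_) eq)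

neighbours : Vec (Subset N) M → Subset M → Subset N
neighbours []       []            = ⊥
neighbours (B ∷ Bs) (inside  ∷ A) = B ∪ neighbours Bs A
neighbours (B ∷ Bs) (outside ∷ A) = neighbours Bs A

neighbours⁺ : (Bs : Vec (Subset N) M) (A : Subset M) {q : Fin M} {s : Fin N} →
              q ∈ A → s ∈ lookup Bs q → s ∈ neighbours Bs A
neighbours⁺ (B ∷ Bs) (inside  ∷ A) here        s∈B = Subset.x∈p∪q⁺ (inj₁ s∈B)
neighbours⁺ (B ∷ Bs) (inside  ∷ A) (there q∈A) s∈B = Subset.x∈p∪q⁺ (inj₂ (neighbours⁺ Bs A q∈A s∈B))
neighbours⁺ (B ∷ Bs) (outside ∷ A) (there q∈A) s∈B = neighbours⁺ Bs A q∈A s∈B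

neighbours⁻ : (Bs : Vec (Subset N) M) (A : Subset M) {s : Fin N} →
              s ∈ neighbours Bs A → ∃[ q ] q ∈ A × s ∈ lookup Bs q
neighbours⁻ []       []            s∈ = contradiction s∈ Subset.∉⊥
neighbours⁻ (B ∷ Bs) (outside ∷ A) s∈ with neighbours⁻ Bs A s∈
... | q , q∈A , s∈B = suc q , there q∈A , s∈B
neighbours⁻ (B ∷ Bs) (inside ∷ A)  s∈ with Subset.x∈p∪q⁻ B (neighbours Bs A) s∈
... | inj₁ s∈B = zero , here , s∈B
... | inj₂ s∈N with neighbours⁻ Bs A s∈N
...   | q , q∈A , s∈B = suc q , there q∈A , s∈B

𝟙 : Dec X → ℕ
𝟙 p = if does p then 1 else 0

-- The use of `r` is paid for by the unit of capacity removed there.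
updateAt-≤ : (c : Fin N → ℕ) (r s : Fin N) → 0 < c r → 𝟙 (r Fin.≟ s) + updateAt c r pred s ≤ c s
updateAt-≤ c zero    zero    0<c with c zero
... | suc _ = ℕ.≤-refl
updateAt-≤ c zero    (suc s) 0<c = ℕ.≤-refl
updateAt-≤ c (suc r) zero    0<c = ℕ.≤-refl
updateAt-≤ c (suc r) (suc s) 0<c = updateAt-≤ (c ∘ suc) r s 0<c

HallCondition : (Fin N → ℕ) → Vec (Subset N) M → Set
HallCondition c Bs = ∀ A → ∣ A ∣ ≤ weight c (neighbours Bs A)

hall-or-violated : (c : Fin N → ℕ) (Bs : Vec (Subset N) M) →
                   HallCondition c Bs ⊎ ∃[ A ] weight c (neighbours Bs A) < ∣ A ∣
hall-or-violated c Bs with Subset.anySubset? (λ A → weight c (neighbours Bs A) ℕ.<? ∣ A ∣)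
... | yes violated = inj₂ violated
... | no ¬violated = inj₁ λ A → ℕ.≮⇒≥ λ lt → ¬violated (A , lt)

module _ (c : Fin N → ℕ) (Bs : Vec (Subset N) M) (hall : HallCondition c Bs) where

  Tight : Subset M → Set
  Tight A = weight c (neighbours Bs A) ≤ ∣ A ∣

  -- Uncrossing: neighbourhoods turn unions into unions and intersections into subsets of
  -- intersections, so their capacity is submodular. Hall's condition at `A ∩ B` then leaves no
  -- slack at `A ∪ B`.
  ∪-tight : ∀ A B → Tight A → Tight B → Tight (A ∪ B)
  ∪-tight A B tA tB = ℕ.+-cancelʳ-≤ (weight c (Γ (A ∩ B))) _ _ (begin
    weight c (Γ (A ∪ B)) + weight c (Γ (A ∩ B))
      ≤⟨ ℕ.+-mono-≤ (weight-mono c _ _ λ s∈ _ → Γ∪ s∈) (weight-mono c _ _ λ s∈ _ → Γ∩ s∈) ⟩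
    weight c (Γ A ∪ Γ B) + weight c (Γ A ∩ Γ B)   ≡⟨ weight-∪∩ c (Γ A) (Γ B) ⟩
    weight c (Γ A) + weight c (Γ B)               ≤⟨ ℕ.+-mono-≤ tA tB ⟩
    ∣ A ∣ + ∣ B ∣                                 ≡⟨ ∣∪∣+∣∩∣ A B ⟨
    ∣ A ∪ B ∣ + ∣ A ∩ B ∣                         ≤⟨ ℕ.+-monoʳ-≤ _ (hall (A ∩ B)) ⟩
    ∣ A ∪ B ∣ + weight c (Γ (A ∩ B))              ∎)
    where
    open ℕ.≤-Reasoning
    Γ = neighbours Bs
    Γ∪ : Γ (A ∪ B) ⊆ Γ A ∪ Γ B
    Γ∪ s∈ with neighbours⁻ Bs (A ∪ B) s∈
    ... | q , q∈ , s∈B = Subset.x∈p∪q⁺ (Sum.map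
      (λ q∈A → neighbours⁺ Bs A q∈A s∈B) (λ q∈B → neighbours⁺ Bs B q∈B s∈B) (Subset.x∈p∪q⁻ A B q∈))
    Γ∩ : Γ (A ∩ B) ⊆ Γ A ∩ Γ B
    Γ∩ s∈ with neighbours⁻ Bs (A ∩ B) s∈
    ... | q , q∈ , s∈B with Subset.x∈p∩q⁻ A B q∈
    ...   | q∈A , q∈B = Subset.x∈p∩q⁺ (neighbours⁺ Bs A q∈A s∈B , neighbours⁺ Bs B q∈B s∈B)

  ⊥-tight : Tight ⊥
  ⊥-tight = ℕ.≤-trans (weight-mono c _ ⊥ λ s∈ _ → contradiction (neighbours⁻ Bs ⊥ s∈)
                                                    λ (_ , q∈⊥ , _) → Subset.∉⊥ q∈⊥)
                      (ℕ.≤-trans (ℕ.≤-reflexive (weight-⊥ c)) z≤n)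
    where
    weight-⊥ : (c : Fin n → ℕ) → weight c ⊥ ≡ 0
    weight-⊥ {zero}  c = refl
    weight-⊥ {suc n} c = weight-⊥ (c ∘ suc)

  -- The union of tight sets chosen along an enumeration `T` stays tight. Keeping `T` apart from the
  -- points allows induction on `k`; it is applied with `T = id`.
  tight-cover : (T : Fin k → Fin N) (Good : Fin N → Set) →
                (∀ i → Good (T i) → ∃[ A ] Tight A × T i ∈ neighbours Bs A) →
                (∀ s → Dec (Good s)) →
                ∃[ A ] Tight A × (∀ i → Good (T i) → T i ∈ neighbours Bs A)
  tight-cover {zero}  T Good tight good? = ⊥ , ⊥-tight , λ ()
  tight-cover {suc k} T Good tight good? with tight-cover (T ∘ suc) Good (tight ∘ suc) good? | good? (T zero)
  ... | A , tA , cov | no ¬g = A , tA , λ { zero g → contradiction g ¬g ; (suc i) g → cov i g }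
  ... | A , tA , cov | yes g with tight zero g
  ...   | B , tB , T∈ = A ∪ B , ∪-tight A B tA tB ,
    λ { zero _ → mono (Subset.q⊆p∪q A B) T∈ ; (suc i) g → mono (Subset.p⊆p∪q B) (cov i g) }
    where
    mono : ∀ {A B s} → A ⊆ B → s ∈ neighbours Bs A → s ∈ neighbours Bs B
    mono {A} {B} A⊆B s∈ with neighbours⁻ Bs A s∈
    ... | q , q∈A , s∈q = neighbours⁺ Bs B (A⊆B q∈A) s∈q

  -- If no admissible s preserves Hall's condition, then every admissible s is a neighbour of a tight
  -- set; the union of these sets is tight and has no new neighbours in B, contradicting hall₁.
  extendible : (B : Subset N) → (∀ A → suc ∣ A ∣ ≤ weight c (B ∪ neighbours Bs A)) →
               ∃[ s ] s ∈ B × 0 < c s × HallCondition (updateAt c s pred) Bs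
  extendible B hall₁ with any? (λ s → (s Subset.∈? B) ×-dec (0 ℕ.<? c s) ×-dec hall? s)
    where
    hall? : ∀ s → Dec (HallCondition (updateAt c s pred) Bs)
    hall? s with hall-or-violated (updateAt c s pred) Bs
    ... | inj₁ hall′          = yes hall′
    ... | inj₂ (A , violated) = no λ hall′ → ℕ.<⇒≱ violated (hall′ A)
  ... | yes found = found
  ... | no  none  with tight-cover id (λ s → s ∈ B × 0 < c s) tight
                                   (λ s → (s Subset.∈? B) ×-dec (0 ℕ.<? c s))
    where
    tight : ∀ s → s ∈ B × 0 < c s → ∃[ A ] Tight A × s ∈ neighbours Bs A
    tight s (s∈B , 0<c) with hall-or-violated (updateAt c s pred) Bs
    ... | inj₁ hall′ = contradiction (s , s∈B , 0<c , hall′) none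
    ... | inj₂ (A , violated) with weight-updateAt c s (neighbours Bs A) 0<c
    ...   | inj₁ (s∈ , eq) = A , subst (_≤ ∣ A ∣) (sym eq) violated , s∈
    ...   | inj₂ eq        = contradiction (subst (∣ A ∣ ≤_) eq (hall A)) (ℕ.<⇒≱ violated)
  ...   | A , tA , cov = contradiction (ℕ.≤-trans (hall₁ A) (ℕ.≤-trans B∪Γ≤Γ tA)) ℕ.1+n≰n
    where
    B∪Γ≤Γ : weight c (B ∪ neighbours Bs A) ≤ weight c (neighbours Bs A)
    B∪Γ≤Γ = weight-mono c _ _ λ s∈ 0<c → Sum.fromInj₂ (λ s∈B → cov _ (s∈B , 0<c)) (Subset.x∈p∪q⁻ B _ s∈)

hall-with-capacities : (c : Fin N → ℕ) (Bs : Vec (Subset N) M) → HallCondition c Bs →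
  ∃[ f ] (∀ q → lookup f q ∈ lookup Bs q) × (∀ s → sumℕ (λ q → 𝟙 (lookup f q Fin.≟ s)) ≤ c s)
hall-with-capacities c []       hall = [] , (λ ()) , λ _ → z≤n
-- Hall's condition for the sets without `B` and for those with `B` gives the two hypotheses of
-- `extendible`.
hall-with-capacities c (B ∷ Bs) hall with extendible c Bs (hall ∘ (outside ∷_)) B (hall ∘ (inside ∷_))
... | s , s∈B , 0<c , hall′ with hall-with-capacities (updateAt c s pred) Bs hall′
...   | f , f∈ , f≤ = s ∷ f , (λ { zero → s∈B ; (suc q) → f∈ q }) ,
  λ r → ℕ.≤-trans (ℕ.+-monoʳ-≤ (𝟙 (s Fin.≟ r)) (f≤ r)) (updateAt-≤ c s r 0<c)

-- Baranyai's theorem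

sum-cong : {f g : Fin n → ℕ} → (∀ i → f i ≡ g i) → sumℕ f ≡ sumℕ g
sum-cong = ℕ∑.sum-cong-≗

sum-+ : (f g : Fin n → ℕ) → sumℕ (λ i → f i + g i) ≡ sumℕ f + sumℕ g
sum-+ = ℕ∑.∑-distrib-+

sum-comm : (f : Fin m → Fin n → ℕ) → sumℕ (λ i → sumℕ (f i)) ≡ sumℕ (λ j → sumℕ λ i → f i j)
sum-comm = ℕ∑.∑-comm

*-sum : ∀ x (f : Fin n → ℕ) → x * sumℕ f ≡ sumℕ (λ i → x * f i)
*-sum = ℕ∑*.*-distribˡ-sum

𝟙-cong : (p : Dec X) (q : Dec Y) → (X → Y) → (Y → X) → 𝟙 p ≡ 𝟙 q
𝟙-cong (yes p) (yes q) to from = refl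
𝟙-cong (no ¬p) (no ¬q) to from = refl
𝟙-cong (yes p) (no ¬q) to from = contradiction (to p) ¬q
𝟙-cong (no ¬p) (yes q) to from = contradiction (from q) ¬p

sum-mono : {f g : Fin n → ℕ} → (∀ i → f i ≤ g i) → sumℕ f ≤ sumℕ g
sum-mono {zero}  f≤g = z≤n
sum-mono {suc n} f≤g = ℕ.+-mono-≤ (f≤g zero) (sum-mono (f≤g ∘ suc))

sum-const : ∀ n x → sumℕ {n} (λ _ → x) ≡ n * x
sum-const zero    x = refl
sum-const (suc n) x = cong (x +_) (sum-const n x)

term≤sum : (f : Fin n → ℕ) (i : Fin n) → f i ≤ sumℕ f
term≤sum f zero    = ℕ.m≤m+n _ _
term≤sum f (suc i) = ℕ.≤-trans (term≤sum (f ∘ suc) i) (ℕ.m≤n+m _ _)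

sum>0⇒term>0 : (f : Fin n → ℕ) → 0 < sumℕ f → ∃[ i ] 0 < f i
sum>0⇒term>0 {suc n} f 0<∑ with f zero in eq
... | suc _ = zero , subst (0 <_) (sym eq) z<s
... | zero  with sum>0⇒term>0 (f ∘ suc) 0<∑
...   | i , 0<fi = suc i , 0<fi

-- Equal totals leave no room for a strict inequality in any term. This turns upper bounds, from
-- Hall's theorem or from injectivity, into exact counts.
sum-≡⇒≗ : (f g : Fin n → ℕ) → (∀ i → f i ≤ g i) → sumℕ g ≤ sumℕ f → ∀ i → f i ≡ g i
sum-≡⇒≗ f g f≤g ∑g≤∑f zero = ℕ.≤-antisym (f≤g zero)
  (ℕ.+-cancelʳ-≤ (sumℕ (g ∘ suc)) _ _ (ℕ.≤-trans ∑g≤∑f (ℕ.+-monoʳ-≤ (f zero) (sum-mono (f≤g ∘ suc)))))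
sum-≡⇒≗ f g f≤g ∑g≤∑f (suc i) = sum-≡⇒≗ (f ∘ suc) (g ∘ suc) (f≤g ∘ suc)
  (ℕ.+-cancelˡ-≤ (g zero) _ _ (ℕ.≤-trans ∑g≤∑f (ℕ.+-monoˡ-≤ _ (f≤g zero)))) i

sum-δ : (x : Fin n) (g : Fin n → ℕ) → sumℕ (λ i → 𝟙 (x Fin.≟ i) * g i) ≡ g x
sum-δ {suc n} zero g = trans (cong₂ _+_ (ℕ.*-identityˡ (g zero)) (ℕ∑.sum-replicate-zero n)) (ℕ.+-identityʳ _)
sum-δ (suc x) g = sum-δ x (g ∘ suc)

χ : Subset n → Fin n → ℕ
χ S i = if lookup S i then 1 else 0

weight≡∑χ : (c : Fin n → ℕ) (S : Subset n) → weight c S ≡ sumℕ (λ i → χ S i * c i)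
weight≡∑χ c []            = refl
weight≡∑χ c (inside  ∷ S) = cong₂ _+_ (sym (ℕ.*-identityˡ (c zero))) (weight≡∑χ (c ∘ suc) S)
weight≡∑χ c (outside ∷ S) = weight≡∑χ (c ∘ suc) S

∣p∣≡∑χ : (S : Subset n) → ∣ S ∣ ≡ sumℕ (χ S)
∣p∣≡∑χ []            = refl
∣p∣≡∑χ (inside  ∷ S) = cong suc (∣p∣≡∑χ S)
∣p∣≡∑χ (outside ∷ S) = ∣p∣≡∑χ S

χ≤χ : (S : Subset m) (T : Subset n) {i : Fin m} {j : Fin n} → (i ∈ S → j ∈ T) → χ S i ≤ χ T j
χ≤χ S T {i} {j} imp with lookup S i in eq
... | false = z≤n
... | true rewrite []=⇒lookup (imp (lookup⇒[]= i S eq)) = ℕ.≤-refl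

∑∑-cong : {f g : Fin m → Fin n → ℕ} → (∀ i j → f i j ≡ g i j) →
          sumℕ (λ i → sumℕ (f i)) ≡ sumℕ (λ i → sumℕ (g i))
∑∑-cong f≗g = sum-cong λ i → sum-cong (f≗g i)

*-distribˡ-∑∑ : ∀ x (f : Fin m → Fin n → ℕ) → x * sumℕ (λ i → sumℕ (f i)) ≡ sumℕ (λ i → sumℕ λ j → x * f i j)
*-distribˡ-∑∑ x f = trans (*-sum x (λ i → sumℕ (f i))) (sum-cong λ i → *-sum x (f i))

-- Double counting of the pairs `q`, `t`, sorted by their image under `r`.
∑-fibres : (r : Fin M → Fin m → Fin N) (w : Fin M → Fin m → ℕ) (x : Fin N → ℕ) →
  sumℕ (λ s → x s * sumℕ (λ q → sumℕ λ t → 𝟙 (r q t Fin.≟ s) * w q t)) ≡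
  sumℕ (λ q → sumℕ λ t → x (r q t) * w q t)
∑-fibres {M} {m} {N} r w x = begin
  sumℕ (λ s → x s * sumℕ (λ q → sumℕ λ t → 𝟙 (r q t Fin.≟ s) * w q t))
    ≡⟨ sum-cong (λ s → *-distribˡ-∑∑ (x s) (λ q t → 𝟙 (r q t Fin.≟ s) * w q t)) ⟩
  sumℕ (λ s → sumℕ λ q → sumℕ λ t → x s * (𝟙 (r q t Fin.≟ s) * w q t))
    ≡⟨ sum-comm {N} {M} _ ⟩
  sumℕ (λ q → sumℕ λ s → sumℕ λ t → x s * (𝟙 (r q t Fin.≟ s) * w q t))
    ≡⟨ sum-cong {M} (λ q → sum-comm {N} {m} _) ⟩
  sumℕ (λ q → sumℕ λ t → sumℕ λ s → x s * (𝟙 (r q t Fin.≟ s) * w q t))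
    ≡⟨ ∑∑-cong (λ q t → trans (sum-cong λ s → x*yz≡y*xz (x s) (𝟙 (r q t Fin.≟ s)) (w q t))
                              (sum-δ (r q t) (λ s → x s * w q t))) ⟩
  sumℕ (λ q → sumℕ λ t → x (r q t) * w q t) ∎
  where open ≡-Reasoning

-- The weights w q t / suc d are a fractional choice of one t for every q; it is rounded to an
-- integral one that preserves the total weight over every fibre of r.
rounding : (d : ℕ) (w : Fin M → Fin m → ℕ) (r : Fin M → Fin m → Fin N) (c : Fin N → ℕ) →
  (∀ q → sumℕ (w q) ≡ suc d) →
  (∀ s → sumℕ (λ q → sumℕ λ t → 𝟙 (r q t Fin.≟ s) * w q t) ≡ suc d * c s) →
  ∃[ f ] ∀ s → sumℕ (λ q → 𝟙 (r q (f q) Fin.≟ s)) ≡ c s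
rounding {M} {m} {N} d w r c out into = from-hall (hall-with-capacities c Bs hall)
  where
  edge? : ∀ q s → Dec (∃[ t ] r q t ≡ s × 0 < w q t)
  edge? q s = any? λ t → (r q t Fin.≟ s) ×-dec (0 ℕ.<? w q t)

  Bs : Vec (Subset N) M
  Bs = tabulate λ q → tabulate λ s → does (edge? q s)

  lookup-Bs : ∀ q s → lookup (lookup Bs q) s ≡ does (edge? q s)
  lookup-Bs q s = trans (cong (λ B → lookup B s) (lookup∘tabulate _ q)) (lookup∘tabulate _ s)

  Bs⁺ : ∀ q t → 0 < w q t → r q t ∈ lookup Bs q
  Bs⁺ q t 0<w = lookup⇒[]= _ _ (trans (lookup-Bs q (r q t)) (dec-true (edge? q _) (t , refl , 0<w)))

  Bs⁻ : ∀ q s → s ∈ lookup Bs q → ∃[ t ] r q t ≡ s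
  Bs⁻ q s s∈ with edge? q s | trans (sym (lookup-Bs q s)) ([]=⇒lookup s∈)
  ... | yes (t , rt≡s , _) | _ = t , rt≡s

  out∑ : ∀ (x : Fin M → ℕ) → sumℕ (λ q → sumℕ λ t → x q * w q t) ≡ suc d * sumℕ x
  out∑ x = begin
    sumℕ (λ q → sumℕ λ t → x q * w q t) ≡⟨ sum-cong (λ q → *-sum (x q) (w q)) ⟨
    sumℕ (λ q → x q * sumℕ (w q))       ≡⟨ sum-cong (λ q → trans (cong (x q *_) (out q)) (ℕ.*-comm (x q) _)) ⟩
    sumℕ (λ q → suc d * x q)            ≡⟨ *-sum (suc d) x ⟨
    suc d * sumℕ x                      ∎
    where open ≡-Reasoning

  into∑ : ∀ (x : Fin N → ℕ) → sumℕ (λ q → sumℕ λ t → x (r q t) * w q t) ≡ suc d * sumℕ (λ s → x s * c s)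
  into∑ x = begin
    sumℕ (λ q → sumℕ λ t → x (r q t) * w q t) ≡⟨ ∑-fibres r w x ⟨
    sumℕ (λ s → x s * sumℕ (λ q → sumℕ λ t → 𝟙 (r q t Fin.≟ s) * w q t))
      ≡⟨ sum-cong (λ s → trans (cong (x s *_) (into s)) (x*yz≡y*xz (x s) (suc d) (c s))) ⟩
    sumℕ (λ s → suc d * (x s * c s))          ≡⟨ *-sum (suc d) (λ s → x s * c s) ⟨
    suc d * sumℕ (λ s → x s * c s)            ∎
    where open ≡-Reasoning

  -- The weight leaving `A` is `suc d` times its size, and all of it enters the neighbours of `A`,
  -- which receive `suc d` times their capacity in total.
  hall : HallCondition c Bs
  hall A = ℕ.*-cancelˡ-≤ (suc d) (begin
    suc d * ∣ A ∣                                            ≡⟨ cong (suc d *_) (∣p∣≡∑χ A) ⟩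
    suc d * sumℕ (χ A)                                       ≡⟨ out∑ (χ A) ⟨
    sumℕ (λ q → sumℕ λ t → χ A q * w q t)                    ≤⟨ sum-mono (λ q → sum-mono λ t → edge q t) ⟩
    sumℕ (λ q → sumℕ λ t → χ Γ (r q t) * w q t)              ≡⟨ into∑ (χ Γ) ⟩
    suc d * sumℕ (λ s → χ Γ s * c s)                         ≡⟨ cong (suc d *_) (weight≡∑χ c Γ) ⟨
    suc d * weight c Γ                                       ∎)
    where
    open ℕ.≤-Reasoning
    Γ = neighbours Bs A
    edge : ∀ q t → χ A q * w q t ≤ χ Γ (r q t) * w q t
    edge q t with w q t in eq
    ... | zero  = ℕ.≤-reflexive (trans (ℕ.*-zeroʳ (χ A q)) (sym (ℕ.*-zeroʳ (χ Γ (r q t)))))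
    ... | suc _ = ℕ.*-monoˡ-≤ _ (χ≤χ A Γ λ q∈A →
      neighbours⁺ Bs A q∈A (Bs⁺ q t (subst (0 <_) (sym eq) z<s)))

  from-hall : ∃[ f ] (∀ q → lookup f q ∈ lookup Bs q) × (∀ s → sumℕ (λ q → 𝟙 (lookup f q Fin.≟ s)) ≤ c s) →
              ∃[ f ] ∀ s → sumℕ (λ q → 𝟙 (r q (f q) Fin.≟ s)) ≡ c s
  from-hall (h , h∈ , h≤) = f , λ s → trans
    (sum-cong λ q → cong (λ x → 𝟙 (x Fin.≟ s)) (proj₂ (Bs⁻ q _ (h∈ q))))
    (sum-≡⇒≗ _ c h≤ total s)
    where
    f : Fin M → Fin m
    f q = proj₁ (Bs⁻ q _ (h∈ q))
    -- Counting the total weight in two ways shows that the capacities add up to `M`, the number of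
    -- choices, so all of Hall's bounds are attained.
    total : sumℕ c ≤ sumℕ (λ s → sumℕ λ q → 𝟙 (lookup h q Fin.≟ s))
    total = ℕ.≤-reflexive (begin
      sumℕ c                                             ≡⟨ sum-cong (λ s → ℕ.*-identityˡ (c s)) ⟨
      sumℕ (λ s → 1 * c s)                               ≡⟨ ℕ.*-cancelˡ-≡ _ _ (suc d)
                                                              (trans (sym (into∑ (λ _ → 1))) (out∑ (λ _ → 1))) ⟩
      sumℕ {M} (λ _ → 1)                                 ≡⟨ sum-cong (λ q → sum-δ (lookup h q) (λ _ → 1)) ⟨
      sumℕ (λ q → sumℕ λ s → 𝟙 (lookup h q Fin.≟ s) * 1) ≡⟨ sum-comm {M} {N} _ ⟩
      sumℕ (λ s → sumℕ λ q → 𝟙 (lookup h q Fin.≟ s) * 1) ≡⟨ ∑∑-cong {N} {M} (λ s q → ℕ.*-identityʳ _) ⟩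
      sumℕ (λ s → sumℕ λ q → 𝟙 (lookup h q Fin.≟ s))     ∎)
      where open ≡-Reasoning

-- Binomial identities for completions of sets

absorption : ∀ n k → suc k * (suc n C suc k) ≡ suc n * (n C k)
absorption zero    zero    = refl
absorption zero    (suc k) = trans (cong (suc (suc k) *_) (k>n⇒nCk≡0 (s<s (z<s {k}))))
  (trans (ℕ.*-zeroʳ (suc (suc k))) (sym (cong (1 *_) (k>n⇒nCk≡0 (z<s {k})))))
absorption (suc n) zero    = trans (cong (1 *_) (nC1≡n (suc (suc n)))) (ℕ.*-comm 1 (suc (suc n)))
absorption (suc n) (suc k) = begin
  suc (suc k) * (suc (suc n) C suc (suc k))     ≡⟨ cong (suc (suc k) *_) (nCk+nC[k+1]≡[n+1]C[k+1] (suc n) (suc k)) ⟨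
  suc (suc k) * (x + (suc n C suc (suc k)))     ≡⟨ ℕ.*-distribˡ-+ (suc (suc k)) x _ ⟩
  (x + suc k * x) + suc (suc k) * (suc n C suc (suc k))
    ≡⟨ cong₂ (λ y z → (x + y) + z) (absorption n k) (absorption n (suc k)) ⟩
  (x + suc n * (n C k)) + suc n * (n C suc k)   ≡⟨ ℕ.+-assoc x _ _ ⟩
  x + (suc n * (n C k) + suc n * (n C suc k))   ≡⟨ cong (x +_) (ℕ.*-distribˡ-+ (suc n) (n C k) _) ⟨
  x + suc n * ((n C k) + (n C suc k))           ≡⟨ cong (λ y → x + suc n * y) (nCk+nC[k+1]≡[n+1]C[k+1] n k) ⟩
  suc (suc n) * x                               ∎
  where
  open ≡-Reasoning
  x = suc n C suc k

-- The number of ways to complete an e-set to a k-set using d further points.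
completions : ℕ → ℕ → ℕ → ℕ
completions d k       zero    = d C k
completions d zero    (suc e) = 0
completions d (suc k) (suc e) = completions d k e

-- A completion either avoids the additional point or contains it, and in the latter case it
-- completes a set of size `suc e`.
completions-pascal : ∀ d k e → completions (suc d) k e ≡ completions d k e + completions d k (suc e)
completions-pascal d zero    zero    = refl
completions-pascal d (suc k) zero    = trans (sym (nCk+nC[k+1]≡[n+1]C[k+1] d k)) (ℕ.+-comm (d C k) _)
completions-pascal d zero    (suc e) = refl
completions-pascal d (suc k) (suc e) = completions-pascal d k e

-- Both sides count completions with one added point marked: the completion is chosen first and then
-- the mark, or the marked point first. For `k ≤ e` both vanish, so the truncated subtraction is
-- harmless.
completions-absorption : ∀ d k e → (k ∸ e) * completions (suc d) k e ≡ suc d * completions d k (suc e)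
completions-absorption d zero    zero    = sym (ℕ.*-zeroʳ d)
completions-absorption d (suc k) zero    = absorption d k
completions-absorption d zero    (suc e) = sym (ℕ.*-zeroʳ d)
completions-absorption d (suc k) (suc e) = completions-absorption d k e

completions-> : ∀ d {k e} → k < e → completions d k e ≡ 0
completions-> d {zero}  {suc e} _         = refl
completions-> d {suc k} {suc e} (s<s k<e) = completions-> d k<e

completions-diagonal : ∀ k → completions 0 k k ≡ 1
completions-diagonal zero    = refl
completions-diagonal (suc k) = completions-diagonal k

-- `rounding` has its targets in some `Fin N`, so the sets that receive the new point are numbered
-- through their indicator bits.
encode : Subset ℓ → Fin (2 ^ ℓ)
encode []      = zero
encode (b ∷ S) = combine (Inverse.from 2↔Bool b) (encode S)

decode : ∀ ℓ → Fin (2 ^ ℓ) → Subset ℓ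
decode zero    _ = []
decode (suc ℓ) s = Inverse.to 2↔Bool (proj₁ (remQuot {2} (2 ^ ℓ) s)) ∷ decode ℓ (proj₂ (remQuot {2} (2 ^ ℓ) s))

encode-decode : ∀ ℓ (s : Fin (2 ^ ℓ)) → encode (decode ℓ s) ≡ s
encode-decode zero    zero = refl
encode-decode (suc ℓ) s    = trans
  (cong₂ combine (Inverse.strictlyInverseʳ 2↔Bool (proj₁ (remQuot {2} (2 ^ ℓ) s)))
                 (encode-decode ℓ (proj₂ (remQuot {2} (2 ^ ℓ) s))))
  (combine-remQuot {2} (2 ^ ℓ) s)

decode-encode : (S : Subset ℓ) → decode ℓ (encode S) ≡ S
decode-encode []              = refl
decode-encode {suc ℓ} (b ∷ S) = trans
  (cong (λ (i , s) → Inverse.to 2↔Bool i ∷ decode ℓ s) (remQuot-combine {2} {2 ^ ℓ} (Inverse.from 2↔Bool b) (encode S)))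
  (cong₂ _∷_ (Inverse.strictlyInverseˡ 2↔Bool b) (decode-encode S))

infix 4 _≟ₛ_
_≟ₛ_ : DecidableEquality (Subset n)
_≟ₛ_ = ≡-dec Bool._≟_

𝟙-∷ : ∀ b (S T : Subset n) → 𝟙 (b ∷ S ≟ₛ outside ∷ T) + 𝟙 (b ∷ S ≟ₛ inside ∷ T) ≡ 𝟙 (S ≟ₛ T)
𝟙-∷ inside  S T = refl
𝟙-∷ outside S T = ℕ.+-identityʳ _

𝟙-inside∷ : ∀ b (S T : Subset n) → 𝟙 (b ∷ S ≟ₛ inside ∷ T) ≡ (if b then 1 else 0) * 𝟙 (S ≟ₛ T)
𝟙-inside∷ inside  S T = sym (ℕ.*-identityˡ (𝟙 (S ≟ₛ T)))
𝟙-inside∷ outside S T = refl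

-- A partition is stored as the vector of the labels of its points: parts are disjoint by
-- construction, may be empty, and receive a new point by `_∷_`.
fibre : Vec (Fin m) ℓ → Fin m → Subset ℓ
fibre g t = map (λ y → does (y Fin.≟ t)) g

∣∷∣ : ∀ b (S : Subset n) → ∣ b ∷ S ∣ ≡ (if b then 1 else 0) + ∣ S ∣
∣∷∣ inside  S = refl
∣∷∣ outside S = refl

∑∣fibre∣ : (g : Vec (Fin m) ℓ) → sumℕ (λ t → ∣ fibre g t ∣) ≡ ℓ
∑∣fibre∣ {m} []      = trans (sum-const m 0) (ℕ.*-zeroʳ m)
∑∣fibre∣ {m} (y ∷ g) = trans (sum-cong λ t → ∣∷∣ (does (y Fin.≟ t)) (fibre g t))
  (trans (sum-+ {m} _ _) (cong₂ _+_
    (trans (sum-cong λ t → sym (ℕ.*-identityʳ (𝟙 (y Fin.≟ t)))) (sum-δ y (λ _ → 1))) (∑∣fibre∣ g)))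

multiplicity : (Fin M → Vec (Fin m) ℓ) → Subset ℓ → ℕ
multiplicity g S = sumℕ λ q → sumℕ λ t → 𝟙 (fibre (g q) t ≟ₛ S)

-- M partitions, each into m labelled and possibly empty parts, of the first ℓ points, that could
-- still be the traces of a factorisation of the complete k-uniform hypergraph on ℓ + d points.
IsTrace : (k d : ℕ) → (Fin M → Vec (Fin m) ℓ) → Set
IsTrace k d g = ∀ S → multiplicity g S ≡ completions d k ∣ S ∣

-- A set with more than `k` points has no completion, so it would have to occur zero times.
∣fibre∣≤k : ∀ {k d} (g : Fin M → Vec (Fin m) ℓ) → IsTrace k d g → ∀ q t → ∣ fibre (g q) t ∣ ≤ k
∣fibre∣≤k {k = k} {d} g trace q t = ℕ.≮⇒≥ λ k<∣S∣ → ℕ.1+n≰n (begin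
  1                                        ≡⟨ cong (λ b → if b then 1 else 0) (dec-true (S ≟ₛ S) refl) ⟨
  𝟙 (fibre (g q) t ≟ₛ S)                   ≤⟨ term≤sum (λ u → 𝟙 (fibre (g q) u ≟ₛ S)) t ⟩
  sumℕ (λ u → 𝟙 (fibre (g q) u ≟ₛ S))      ≤⟨ term≤sum (λ p → sumℕ λ u → 𝟙 (fibre (g p) u ≟ₛ S)) q ⟩
  multiplicity g S                         ≡⟨ trace S ⟩
  completions d k ∣ S ∣                    ≡⟨ completions-> d k<∣S∣ ⟩
  0                                        ∎)
  where
  open ℕ.≤-Reasoning
  S = fibre (g q) t

-- Join partition `q` to each of its parts by as many edges as the part lacks points. The degree of
-- `q` is then m k - ℓ, which is `suc d`, and the degree of a set `S` is `suc d` times the number of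
-- hyperedges that have trace `S` and contain the new point. `rounding` selects for every partition
-- the part that receives this point.
extend-trace : ∀ {k d} (g : Fin M → Vec (Fin m) ℓ) → IsTrace k (suc d) g → ℓ + suc d ≡ m * k →
               ∃[ f ] IsTrace k d (λ q → f q ∷ g q)
extend-trace {M} {m} {ℓ} {k} {d} g trace ℓ+d≡mk = from-rounding (rounding d w r c out into)
  where
  w : Fin M → Fin m → ℕ
  w q t = k ∸ ∣ fibre (g q) t ∣
  r : Fin M → Fin m → Fin (2 ^ ℓ)
  r q t = encode (fibre (g q) t)
  c : Fin (2 ^ ℓ) → ℕ
  c s = completions d k (suc ∣ decode ℓ s ∣)

  out : ∀ q → sumℕ (w q) ≡ suc d
  out q = ℕ.+-cancelʳ-≡ ℓ _ _ (begin
    sumℕ (w q) + ℓ                                           ≡⟨ cong (sumℕ (w q) +_) (∑∣fibre∣ (g q)) ⟨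
    sumℕ (w q) + sumℕ (λ t → ∣ fibre (g q) t ∣)              ≡⟨ sum-+ (w q) _ ⟨
    sumℕ (λ t → (k ∸ ∣ fibre (g q) t ∣) + ∣ fibre (g q) t ∣) ≡⟨ sum-cong (λ t → ℕ.m∸n+n≡m (∣fibre∣≤k g trace q t)) ⟩
    sumℕ {m} (λ _ → k)                                       ≡⟨ sum-const m k ⟩
    m * k                                                    ≡⟨ ℓ+d≡mk ⟨
    ℓ + suc d                                                ≡⟨ ℕ.+-comm ℓ (suc d) ⟩
    suc d + ℓ                                                ∎)
    where open ≡-Reasoning

  into : ∀ s → sumℕ (λ q → sumℕ λ t → 𝟙 (r q t Fin.≟ s) * w q t) ≡ suc d * c s
  into s = begin
    sumℕ (λ q → sumℕ λ t → 𝟙 (r q t Fin.≟ s) * w q t)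
      ≡⟨ ∑∑-cong {M} {m} pointwise ⟩
    sumℕ (λ q → sumℕ λ t → (k ∸ ∣ S ∣) * 𝟙 (fibre (g q) t ≟ₛ S))
      ≡⟨ *-distribˡ-∑∑ (k ∸ ∣ S ∣) (λ q t → 𝟙 (fibre (g q) t ≟ₛ S)) ⟨
    (k ∸ ∣ S ∣) * multiplicity g S
      ≡⟨ cong ((k ∸ ∣ S ∣) *_) (trace S) ⟩
    (k ∸ ∣ S ∣) * completions (suc d) k ∣ S ∣
      ≡⟨ completions-absorption d k ∣ S ∣ ⟩
    suc d * c s ∎
    where
    open ≡-Reasoning
    S = decode ℓ s
    pointwise : ∀ q t → 𝟙 (r q t Fin.≟ s) * w q t ≡ (k ∸ ∣ S ∣) * 𝟙 (fibre (g q) t ≟ₛ S)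
    pointwise q t with r q t Fin.≟ s | fibre (g q) t ≟ₛ S
    ... | yes _    | yes fib≡S = trans (ℕ.*-identityˡ _) (trans (cong (λ T → k ∸ ∣ T ∣) fib≡S) (sym (ℕ.*-identityʳ _)))
    ... | yes r≡s  | no fib≢S  = contradiction (trans (sym (decode-encode _)) (cong (decode ℓ) r≡s)) fib≢S
    ... | no r≢s   | yes fib≡S = contradiction (trans (cong encode fib≡S) (encode-decode ℓ s)) r≢s
    ... | no _     | no _      = sym (ℕ.*-zeroʳ (k ∸ ∣ S ∣))

  from-rounding : ∃[ f ] (∀ s → sumℕ (λ q → 𝟙 (r q (f q) Fin.≟ s)) ≡ c s) →
                  ∃[ f ] IsTrace k d (λ q → f q ∷ g q)
  from-rounding (f , f-count) = f , λ { (inside ∷ S) → with-new S ; (outside ∷ S) → without-new S }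
    where
    open ≡-Reasoning
    g′ : Fin M → Vec (Fin m) (suc ℓ)
    g′ q = f q ∷ g q

    with-new : ∀ S → multiplicity g′ (inside ∷ S) ≡ completions d k (suc ∣ S ∣)
    with-new S = begin
      multiplicity g′ (inside ∷ S)
        ≡⟨ ∑∑-cong {M} {m} (λ q t → 𝟙-inside∷ (does (f q Fin.≟ t)) (fibre (g q) t) S) ⟩
      sumℕ (λ q → sumℕ λ t → 𝟙 (f q Fin.≟ t) * 𝟙 (fibre (g q) t ≟ₛ S))
        ≡⟨ sum-cong {M} (λ q → sum-δ (f q) (λ t → 𝟙 (fibre (g q) t ≟ₛ S))) ⟩
      sumℕ (λ q → 𝟙 (fibre (g q) (f q) ≟ₛ S))
        ≡⟨ sum-cong {M} (λ q → 𝟙-cong (fibre (g q) (f q) ≟ₛ S) (r q (f q) Fin.≟ encode S) (cong encode)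
             λ eq → trans (sym (decode-encode _)) (trans (cong (decode ℓ) eq) (decode-encode S))) ⟩
      sumℕ (λ q → 𝟙 (r q (f q) Fin.≟ encode S))
        ≡⟨ f-count (encode S) ⟩
      completions d k (suc ∣ decode ℓ (encode S) ∣)
        ≡⟨ cong (λ T → completions d k (suc ∣ T ∣)) (decode-encode S) ⟩
      completions d k (suc ∣ S ∣) ∎

    -- The sets with and without the new point together account for every old part equal to `S`, and
    -- Pascal's rule splits their number in the same way.
    without-new : ∀ S → multiplicity g′ (outside ∷ S) ≡ completions d k ∣ S ∣
    without-new S = ℕ.+-cancelʳ-≡ (completions d k (suc ∣ S ∣)) _ _ (begin
      multiplicity g′ (outside ∷ S) + completions d k (suc ∣ S ∣)
        ≡⟨ cong (multiplicity g′ (outside ∷ S) +_) (with-new S) ⟨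
      multiplicity g′ (outside ∷ S) + multiplicity g′ (inside ∷ S)
        ≡⟨ sum-+ {M} _ _ ⟨
      sumℕ (λ q → sumℕ (λ t → 𝟙 (fibre (g′ q) t ≟ₛ outside ∷ S)) + sumℕ (λ t → 𝟙 (fibre (g′ q) t ≟ₛ inside ∷ S)))
        ≡⟨ sum-cong {M} (λ q → trans (sym (sum-+ {m} _ _))
             (sum-cong {m} (λ t → 𝟙-∷ (does (f q Fin.≟ t)) (fibre (g q) t) S))) ⟩
      multiplicity g S
        ≡⟨ trace S ⟩
      completions (suc d) k ∣ S ∣
        ≡⟨ completions-pascal d k ∣ S ∣ ⟩
      completions d k ∣ S ∣ + completions d k (suc ∣ S ∣) ∎)

traces : ∀ {k n} → n ≡ m * k → M * m ≡ n C k → ∀ ℓ d → ℓ + d ≡ n →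
         ∃[ g ] IsTrace {M} {m} {ℓ} k d g
-- Before any point is placed, all `M * m` parts are empty, and each of the `n C k` hyperedges has
-- the empty trace.
traces {m} {M} {k} n≡mk Mm≡nCk zero d refl = (λ _ → []) , λ { [] → begin
  sumℕ {M} (λ _ → sumℕ {m} (λ _ → 1)) ≡⟨ sum-cong {M} (λ _ → sum-const m 1) ⟩
  sumℕ {M} (λ _ → m * 1)              ≡⟨ sum-const M (m * 1) ⟩
  M * (m * 1)                         ≡⟨ cong (M *_) (ℕ.*-identityʳ m) ⟩
  M * m                               ≡⟨ Mm≡nCk ⟩
  d C k                               ∎ }
  where open ≡-Reasoning
traces {m} {M} n≡mk Mm≡nCk (suc ℓ) d ℓ+d≡n =
  let g , trace  = traces {m} {M} n≡mk Mm≡nCk ℓ (suc d) (trans (ℕ.+-suc ℓ d) ℓ+d≡n)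
      f , trace′ = extend-trace g trace (trans (ℕ.+-suc ℓ d) (trans ℓ+d≡n n≡mk))
  in (λ q → f q ∷ g q) , trace′

𝟙>0⇒ : (p : Dec X) → 0 < 𝟙 p → X
𝟙>0⇒ (yes p) _ = p

lookup-fibre : (g : Vec (Fin m) ℓ) (t : Fin m) (x : Fin ℓ) → x ∈ fibre g t → lookup g x ≡ t
lookup-fibre (y ∷ g) t (suc x) (there x∈) = lookup-fibre g t x x∈
lookup-fibre (y ∷ g) t zero x∈ with y Fin.≟ t | []=⇒lookup x∈
... | yes y≡t | _ = y≡t

-- A factorisation of the complete k-uniform hypergraph, seen as a proper edge colouring.
record Factorisation (k n M : ℕ) : Set where
  field
    colour : (S : Subset n) → ∣ S ∣ ≡ k → Fin M
    proper : ∀ {S T x} p q → x ∈ S → x ∈ T → colour S p ≡ colour T q → S ≡ T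

-- Positive multiplicity exhibits `S` as a part of some partition, whose index becomes its colour.
-- Parts of one partition that share a point are fibres over the same label, hence equal.
factorisation : ∀ {k n} (g : Fin M → Vec (Fin m) n) →
                (∀ S → ∣ S ∣ ≡ k → 0 < multiplicity g S) → Factorisation k n M
factorisation {M} {m} {k} g covered = record
  { colour = λ S p → proj₁ (part S p)
  ; proper = λ {S} {T} p q x∈S x∈T same → disjoint x∈S x∈T same (proj₂ (proj₂ (part S p))) (proj₂ (proj₂ (part T q)))
  }
  where
  find-part : ∀ S → 0 < multiplicity g S → ∃[ q ] ∃[ t ] fibre (g q) t ≡ S
  find-part S 0<∑∑ =
    let q , 0<∑ = sum>0⇒term>0 (λ q → sumℕ λ t → 𝟙 (fibre (g q) t ≟ₛ S)) 0<∑∑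
        t , 0<𝟙 = sum>0⇒term>0 (λ t → 𝟙 (fibre (g q) t ≟ₛ S)) 0<∑
    in q , t , 𝟙>0⇒ (fibre (g q) t ≟ₛ S) 0<𝟙

  part : ∀ S → ∣ S ∣ ≡ k → ∃[ q ] ∃[ t ] fibre (g q) t ≡ S
  part S ∣S∣≡k = find-part S (covered S ∣S∣≡k)

  disjoint : ∀ {S T x q r s t} → x ∈ S → x ∈ T → q ≡ r → fibre (g q) s ≡ S → fibre (g r) t ≡ T → S ≡ T
  disjoint {x = x} {q} {s = s} {t} x∈S x∈T refl refl refl =
    cong (fibre (g q)) (trans (sym (lookup-fibre (g q) s x x∈S)) (lookup-fibre (g q) t x x∈T))

baranyai : ∀ k n m → suc n ≡ m * suc k → Factorisation (suc k) (suc n) (n C k)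
baranyai k n m n≡mk = factorisation (proj₁ final) λ S ∣S∣≡k → subst (0 <_)
  (sym (trans (proj₂ final S) (trans (cong (completions 0 (suc k)) ∣S∣≡k) (completions-diagonal k)))) z<s
  where
  open ≡-Reasoning
  -- Each of the `n C k` partitions, as many as there are hyperedges through a point, consists of
  -- `m` hyperedges; absorption shows that this accounts for all of them.
  count : (n C k) * m ≡ suc n C suc k
  count = ℕ.*-cancelˡ-≡ _ _ (suc k) (begin
    suc k * ((n C k) * m)    ≡⟨ ℕ.*-comm (suc k) _ ⟩
    (n C k) * m * suc k      ≡⟨ ℕ.*-assoc (n C k) m (suc k) ⟩
    (n C k) * (m * suc k)    ≡⟨ cong ((n C k) *_) n≡mk ⟨
    (n C k) * suc n          ≡⟨ ℕ.*-comm (n C k) (suc n) ⟩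
    suc n * (n C k)          ≡⟨ absorption n k ⟨
    suc k * (suc n C suc k)  ∎)
  final : ∃[ g ] IsTrace {n C k} {m} {suc n} (suc k) 0 g
  final = traces {m} {n C k} n≡mk count (suc n) 0 (ℕ.+-identityʳ (suc n))

-- Latin labellings

∣⁅x⁆∪p∣ : {x : Fin n} {S : Subset n} → x ∉ S → ∣ ⁅ x ⁆ ∪ S ∣ ≡ suc ∣ S ∣
∣⁅x⁆∪p∣ {x = zero}  {inside  ∷ S} x∉S = contradiction here x∉S
∣⁅x⁆∪p∣ {x = zero}  {outside ∷ S} x∉S = cong (suc ∘ ∣_∣) (Subset.∪-identityˡ S)
∣⁅x⁆∪p∣ {x = suc x} {inside  ∷ S} x∉S = cong suc (∣⁅x⁆∪p∣ (x∉S ∘ there))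
∣⁅x⁆∪p∣ {x = suc x} {outside ∷ S} x∉S = ∣⁅x⁆∪p∣ (x∉S ∘ there)

∈⁅x⁆∪p⁻ : {x y : Fin n} {S : Subset n} → y ∈ ⁅ x ⁆ ∪ S → y ≡ x ⊎ y ∈ S
∈⁅x⁆∪p⁻ {x = x} {S = S} y∈ = Sum.map₁ (Subset.x∈⁅y⁆⇒x≡y x) (Subset.x∈p∪q⁻ ⁅ x ⁆ S y∈)

x∈⁅x⁆∪p : (x : Fin n) (S : Subset n) → x ∈ ⁅ x ⁆ ∪ S
x∈⁅x⁆∪p x S = Subset.p⊆p∪q S (Subset.x∈⁅x⁆ x)

pair : Fin n → Fin n → Subset n
pair x y = ⁅ x ⁆ ∪ ⁅ y ⁆

triple : Fin n → Fin n → Fin n → Subset n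
triple x y z = ⁅ x ⁆ ∪ pair y z

∈pair⁻ : {x y z : Fin n} → z ∈ pair x y → z ≡ x ⊎ z ≡ y
∈pair⁻ {y = y} z∈ = Sum.map₂ (Subset.x∈⁅y⁆⇒x≡y y) (∈⁅x⁆∪p⁻ z∈)

pair-comm : (x y : Fin n) → pair x y ≡ pair y x
pair-comm x y = Subset.∪-comm ⁅ x ⁆ ⁅ y ⁆

triple-rotate : (x y z : Fin n) → triple x y z ≡ triple y z x
triple-rotate x y z = trans (Subset.∪-comm ⁅ x ⁆ (pair y z)) (Subset.∪-assoc ⁅ y ⁆ ⁅ z ⁆ ⁅ x ⁆)

∣pair∣ : {x y : Fin n} → x ≢ y → ∣ pair x y ∣ ≡ 2
∣pair∣ {y = y} x≢y = trans (∣⁅x⁆∪p∣ (Subset.x≢y⇒x∉⁅y⁆ x≢y)) (cong suc (Subset.∣⁅x⁆∣≡1 y))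

∣triple∣ : {x y z : Fin n} → x ≢ y → y ≢ z → x ≢ z → ∣ triple x y z ∣ ≡ 3
∣triple∣ x≢y y≢z x≢z = trans (∣⁅x⁆∪p∣ (Sum.[ x≢y , x≢z ] ∘ ∈pair⁻)) (cong suc (∣pair∣ y≢z))

pair-injective : {x y y′ : Fin n} → x ≢ y → pair x y ≡ pair x y′ → y ≡ y′
pair-injective {x = x} {y} {y′} x≢y eq = Sum.fromInj₂ (λ y≡x → contradiction (sym y≡x) x≢y)
  (∈pair⁻ (subst (y ∈_) eq (Subset.q⊆p∪q ⁅ x ⁆ ⁅ y ⁆ (Subset.x∈⁅x⁆ y))))

-- `x` is common to both sets, so the other two points agree up to order; their exchange is excluded
-- later by the orientation.
triple-injective : {x y z y′ z′ : Fin n} → x ≢ y → y ≢ z → x ≢ z →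
  triple x y z ≡ triple x y′ z′ → (y ≡ y′ × z ≡ z′) ⊎ (y ≡ z′ × z ≡ y′)
triple-injective {x = x} {y} {z} {y′} {z′} x≢y y≢z x≢z eq = cases (among y x≢y y∈) (among z x≢z z∈)
  where
  y∈ : y ∈ triple x y z
  y∈ = Subset.q⊆p∪q ⁅ x ⁆ _ (x∈⁅x⁆∪p y ⁅ z ⁆)
  z∈ : z ∈ triple x y z
  z∈ = Subset.q⊆p∪q ⁅ x ⁆ _ (Subset.q⊆p∪q ⁅ y ⁆ _ (Subset.x∈⁅x⁆ z))
  among : ∀ w → x ≢ w → w ∈ triple x y z → w ≡ y′ ⊎ w ≡ z′
  among w x≢w w∈ = ∈pair⁻ (Sum.fromInj₂ (λ w≡x → contradiction (sym w≡x) x≢w) (∈⁅x⁆∪p⁻ (subst (w ∈_) eq w∈)))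
  cases : y ≡ y′ ⊎ y ≡ z′ → z ≡ y′ ⊎ z ≡ z′ → (y ≡ y′ × z ≡ z′) ⊎ (y ≡ z′ × z ≡ y′)
  cases (inj₁ y≡y′) (inj₂ z≡z′) = inj₁ (y≡y′ , z≡z′)
  cases (inj₂ y≡z′) (inj₁ z≡y′) = inj₂ (y≡z′ , z≡y′)
  cases (inj₁ y≡y′) (inj₁ z≡y′) = contradiction (trans y≡y′ (sym z≡y′)) y≢z
  cases (inj₂ y≡z′) (inj₂ z≡z′) = contradiction (trans y≡z′ (sym z≡z′)) y≢z

module _ (F : Factorisation k n M) where
  open Factorisation F

  colour-cong : ∀ {S T} p q → S ≡ T → colour S p ≡ colour T q
  colour-cong {S} p q refl = cong (colour S) (ℕ.≡-irrelevant p q)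

-- Around the cycle of distinct `i`, `j`, `l`, one or two of the three steps ascend; the parity of
-- their number tells the two cyclic orders apart.
orientation : Fin n → Fin n → Fin n → Bool
orientation i j l = does (i Fin.<? j) xor (does (j Fin.<? l) xor does (l Fin.<? i))

orientation-rotate : (i j l : Fin n) → orientation i j l ≡ orientation j l i
orientation-rotate i j l = trans (Bool.xor-comm (does (i Fin.<? j)) _)
  (Bool.xor-assoc (does (j Fin.<? l)) (does (l Fin.<? i)) (does (i Fin.<? j)))

flip-< : {i j : Fin n} → i ≢ j → does (i Fin.<? j) ≡ not (does (j Fin.<? i))
flip-< {i = i} {j} i≢j with Fin.<-cmp i j
... | tri< i<j _ j≮i = trans (dec-true (i Fin.<? j) i<j) (cong not (sym (dec-false (j Fin.<? i) j≮i)))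
... | tri≈ _ i≡j _   = contradiction i≡j i≢j
... | tri> i≮j _ j<i = trans (dec-false (i Fin.<? j) i≮j) (cong not (sym (dec-true (j Fin.<? i) j<i)))

-- Exchanging `j` and `l` reverses all three comparisons, and three negations change the parity.
orientation-swap : (i j l : Fin n) → i ≢ j → j ≢ l → i ≢ l → orientation i j l ≢ orientation i l j
orientation-swap i j l i≢j j≢l i≢l
  rewrite flip-< i≢j | flip-< j≢l | flip-< (i≢l ∘ sym) =
  differ (does (j Fin.<? i)) (does (l Fin.<? j)) (does (i Fin.<? l))
  where
  differ : ∀ a b c → (not a xor (not b xor not c)) ≢ (c xor (b xor a))
  differ true  true  true  ()
  differ true  true  false ()
  differ true  false true  ()
  differ true  false false ()
  differ false true  true  ()
  differ false true  false ()
  differ false false true  ()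
  differ false false false ()

-- Labels of the positions (i,i,i), of the three types of positions with exactly two equal
-- coordinates (in type a the coordinate 2 − a, counted from 0, is the exceptional one), and of the
-- positions with distinct coordinates.
record Labels (v : ℕ) (X : Set) : Set where
  field
    O : X
    P : Fin 3 → (i j : Fin v) → i ≢ j → X
    T : (i j l : Fin v) → i ≢ j → j ≢ l → i ≢ l → X
    P-sym : ∀ {a i j} p q → P a i j p ≡ P a j i q
    P-injective : ∀ {a b i j j′} p q → P a i j p ≡ P b i j′ q → a ≡ b × j ≡ j′
    T-rotate : ∀ {i j l} p q r p′ q′ r′ → T i j l p q r ≡ T j l i p′ q′ r′
    T-injective : ∀ {i j l j′ l′} p q r p′ q′ r′ → T i j l p q r ≡ T i j′ l′ p′ q′ r′ → j ≡ j′ × l ≡ l′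
    O≢P : ∀ {a i j} p → O ≢ P a i j p
    O≢T : ∀ {i j l} p q r → O ≢ T i j l p q r
    P≢T : ∀ {a i j j′ l′} p p′ q′ r′ → P a i j p ≢ T i j′ l′ p′ q′ r′

data Shape {v : ℕ} : Fin v → Fin v → Fin v → Set where
  iii : ∀ {i} → Shape i i i
  iij : ∀ {i j} → i ≢ j → Shape i i j
  iji : ∀ {i j} → i ≢ j → Shape i j i
  ijj : ∀ {i j} → i ≢ j → Shape i j j
  ijl : ∀ {i j l} → i ≢ j → j ≢ l → i ≢ l → Shape i j l

shape : (i j l : Fin v) → Shape i j l
shape i j l with i Fin.≟ j | j Fin.≟ l | i Fin.≟ l
... | yes refl | yes refl | _        = iii
... | yes refl | no j≢l   | _        = iij j≢l
... | no i≢j   | yes refl | _        = ijj i≢j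
... | no i≢j   | no _     | yes refl = iji i≢j
... | no i≢j   | no j≢l   | no i≢l   = ijl i≢j j≢l i≢l

rotate : {i j l : Fin v} → Shape i j l → Shape j l i
rotate iii           = iii
rotate (iij p)       = iji p
rotate (iji p)       = ijj (p ∘ sym)
rotate (ijj p)       = iij (p ∘ sym)
rotate (ijl p q r)   = ijl q (r ∘ sym) (p ∘ sym)

module _ {X : Set} where

  shapeLabel : Labels v X → {i j l : Fin v} → Shape i j l → X
  shapeLabel L iii                 = Labels.O L
  shapeLabel L (iij {i} {j} p)     = Labels.P L 0F i j p
  shapeLabel L (iji {i} {j} p)     = Labels.P L 1F i j p
  shapeLabel L (ijj {i} {j} p)     = Labels.P L 2F i j p
  shapeLabel L (ijl p q r)         = Labels.T L _ _ _ p q r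

  label : Labels v X → Fin v → Fin v → Fin v → X
  label L i j l = shapeLabel L (shape i j l)

  -- The cyclic shift of coordinates carries the labelling of `L` to that of `rotateLabels L`, which
  -- reduces injectivity on layers to the first direction.
  rotateLabels : Labels v X → Labels v X
  rotateLabels L = record
    { O = O ; P = P ∘ ρ ; T = T ; P-sym = P-sym
    ; P-injective = λ p q eq → Product.map₁ ρ-injective (P-injective p q eq)
    ; T-rotate = T-rotate ; T-injective = T-injective ; O≢P = O≢P ; O≢T = O≢T ; P≢T = P≢T }
    where
    open Labels L
    -- The shift from (i, j, l) to (j, l, i) moves the exceptional coordinate down by one modulo 3
    -- and hence the type up by one; `ρ` undoes this.
    ρ : Fin 3 → Fin 3
    ρ 0F = 2F
    ρ 1F = 0F
    ρ 2F = 1F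
    ρ-injective : ∀ {a b} → ρ a ≡ ρ b → a ≡ b
    ρ-injective {0F} {0F} _ = refl
    ρ-injective {1F} {1F} _ = refl
    ρ-injective {2F} {2F} _ = refl
    ρ-injective {0F} {1F} ()
    ρ-injective {0F} {2F} ()
    ρ-injective {1F} {0F} ()
    ρ-injective {1F} {2F} ()
    ρ-injective {2F} {0F} ()
    ρ-injective {2F} {1F} ()

  module _ (L : Labels v X) where
    open Labels L

    -- Two uses of `P-sym`, or three of `T-rotate`, lead back to the same indices with any other
    -- inequality proofs. Shapes of different kinds exclude each other.
    shapeLabel-irrelevant : {i j l : Fin v} (s t : Shape i j l) → shapeLabel L s ≡ shapeLabel L t
    shapeLabel-irrelevant iii         iii         = refl
    shapeLabel-irrelevant iii         (iij p)     = contradiction refl p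
    shapeLabel-irrelevant iii         (iji p)     = contradiction refl p
    shapeLabel-irrelevant iii         (ijj p)     = contradiction refl p
    shapeLabel-irrelevant iii         (ijl p _ _) = contradiction refl p
    shapeLabel-irrelevant (iij p)     iii         = contradiction refl p
    shapeLabel-irrelevant (iij p)     (iij q)     = trans (P-sym p (p ∘ sym)) (P-sym (p ∘ sym) q)
    shapeLabel-irrelevant (iij p)     (iji q)     = contradiction refl q
    shapeLabel-irrelevant (iij p)     (ijj q)     = contradiction refl q
    shapeLabel-irrelevant (iij p)     (ijl q _ _) = contradiction refl q
    shapeLabel-irrelevant (iji p)     iii         = contradiction refl p
    shapeLabel-irrelevant (iji p)     (iij q)     = contradiction refl p
    shapeLabel-irrelevant (iji p)     (iji q)     = trans (P-sym p (p ∘ sym)) (P-sym (p ∘ sym) q)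
    shapeLabel-irrelevant (iji p)     (ijj q)     = contradiction refl q
    shapeLabel-irrelevant (iji p)     (ijl _ _ q) = contradiction refl q
    shapeLabel-irrelevant (ijj p)     iii         = contradiction refl p
    shapeLabel-irrelevant (ijj p)     (iij q)     = contradiction refl p
    shapeLabel-irrelevant (ijj p)     (iji q)     = contradiction refl p
    shapeLabel-irrelevant (ijj p)     (ijj q)     = trans (P-sym p (p ∘ sym)) (P-sym (p ∘ sym) q)
    shapeLabel-irrelevant (ijj p)     (ijl _ q _) = contradiction refl q
    shapeLabel-irrelevant (ijl p _ _) iii         = contradiction refl p
    shapeLabel-irrelevant (ijl p _ _) (iij q)     = contradiction refl p
    shapeLabel-irrelevant (ijl _ _ p) (iji q)     = contradiction refl p
    shapeLabel-irrelevant (ijl _ p _) (ijj q)     = contradiction refl p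
    shapeLabel-irrelevant (ijl p q r) (ijl p′ q′ r′) = trans (T-rotate p q r q (r ∘ sym) (p ∘ sym))
      (trans (T-rotate q (r ∘ sym) (p ∘ sym) (r ∘ sym) p (q ∘ sym)) (T-rotate (r ∘ sym) p (q ∘ sym) p′ q′ r′))

    shapeLabel-injective : {i j l j′ l′ : Fin v} (s : Shape i j l) (t : Shape i j′ l′) →
                           shapeLabel L s ≡ shapeLabel L t → j ≡ j′ × l ≡ l′
    shapeLabel-injective iii         iii         eq = refl , refl
    shapeLabel-injective iii         (iij p)     eq = contradiction eq (O≢P p)
    shapeLabel-injective iii         (iji p)     eq = contradiction eq (O≢P p)
    shapeLabel-injective iii         (ijj p)     eq = contradiction eq (O≢P p)
    shapeLabel-injective iii         (ijl p q r) eq = contradiction eq (O≢T p q r)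
    shapeLabel-injective (iij p)     iii         eq = contradiction (sym eq) (O≢P p)
    shapeLabel-injective (iij p)     (iij q)     eq = refl , proj₂ (P-injective p q eq)
    shapeLabel-injective (iij p)     (iji q)     eq = contradiction (proj₁ (P-injective p q eq)) λ ()
    shapeLabel-injective (iij p)     (ijj q)     eq = contradiction (proj₁ (P-injective p q eq)) λ ()
    shapeLabel-injective (iij p)     (ijl q r s) eq = contradiction eq (P≢T p q r s)
    shapeLabel-injective (iji p)     iii         eq = contradiction (sym eq) (O≢P p)
    shapeLabel-injective (iji p)     (iij q)     eq = contradiction (proj₁ (P-injective p q eq)) λ ()
    shapeLabel-injective (iji p)     (iji q)     eq = proj₂ (P-injective p q eq) , refl
    shapeLabel-injective (iji p)     (ijj q)     eq = contradiction (proj₁ (P-injective p q eq)) λ ()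
    shapeLabel-injective (iji p)     (ijl q r s) eq = contradiction eq (P≢T p q r s)
    shapeLabel-injective (ijj p)     iii         eq = contradiction (sym eq) (O≢P p)
    shapeLabel-injective (ijj p)     (iij q)     eq = contradiction (proj₁ (P-injective p q eq)) λ ()
    shapeLabel-injective (ijj p)     (iji q)     eq = contradiction (proj₁ (P-injective p q eq)) λ ()
    shapeLabel-injective (ijj p)     (ijj q)     eq = proj₂ (P-injective p q eq) , proj₂ (P-injective p q eq)
    shapeLabel-injective (ijj p)     (ijl q r s) eq = contradiction eq (P≢T p q r s)
    shapeLabel-injective (ijl p q r) iii         eq = contradiction (sym eq) (O≢T p q r)
    shapeLabel-injective (ijl p q r) (iij s)     eq = contradiction (sym eq) (P≢T s p q r)
    shapeLabel-injective (ijl p q r) (iji s)     eq = contradiction (sym eq) (P≢T s p q r)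
    shapeLabel-injective (ijl p q r) (ijj s)     eq = contradiction (sym eq) (P≢T s p q r)
    shapeLabel-injective (ijl p q r) (ijl p′ q′ r′) eq = T-injective p q r p′ q′ r′ eq

    shapeLabel-rotate : {i j l : Fin v} (s : Shape i j l) →
                        shapeLabel L s ≡ shapeLabel (rotateLabels L) (rotate s)
    shapeLabel-rotate iii         = refl
    shapeLabel-rotate (iij p)     = refl
    shapeLabel-rotate (iji p)     = P-sym p (p ∘ sym)
    shapeLabel-rotate (ijj p)     = P-sym p (p ∘ sym)
    shapeLabel-rotate (ijl p q r) = T-rotate p q r _ _ _

    label-cyclic : ∀ {i j l} → i ≢ j → j ≢ l → i ≢ l → label L i j l ≡ label L j l i
    label-cyclic {i} {j} {l} p q r = trans (shapeLabel-irrelevant (shape i j l) (ijl p q r))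
      (trans (T-rotate p q r _ _ _) (shapeLabel-irrelevant (ijl q (r ∘ sym) (p ∘ sym)) (shape j l i)))

    label-iij : ∀ i j → label L i i j ≡ label L j j i
    label-iij i j = case i Fin.≟ j of λ where
      (yes refl) → refl
      (no p)     → trans (shapeLabel-irrelevant (shape i i j) (iij p))
        (trans (P-sym p (p ∘ sym)) (shapeLabel-irrelevant (iij (p ∘ sym)) (shape j j i)))

    label-iji : ∀ i j → label L i j i ≡ label L j i j
    label-iji i j = case i Fin.≟ j of λ where
      (yes refl) → refl
      (no p)     → trans (shapeLabel-irrelevant (shape i j i) (iji p))
        (trans (P-sym p (p ∘ sym)) (shapeLabel-irrelevant (iji (p ∘ sym)) (shape j i j)))

    label-ijj : ∀ i j → label L i j j ≡ label L j i i
    label-ijj i j = case i Fin.≟ j of λ where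
      (yes refl) → refl
      (no p)     → trans (shapeLabel-irrelevant (shape i j j) (ijj p))
        (trans (P-sym p (p ∘ sym)) (shapeLabel-irrelevant (ijj (p ∘ sym)) (shape j i i)))

    label-injective₀ : ∀ {i j l j′ l′} → label L i j l ≡ label L i j′ l′ → j ≡ j′ × l ≡ l′
    label-injective₀ {i} {j} {l} {j′} {l′} = shapeLabel-injective (shape i j l) (shape i j′ l′)

  label-rotate : (L : Labels v X) → ∀ i j l → label L i j l ≡ label (rotateLabels L) j l i
  label-rotate L i j l = trans (shapeLabel-rotate L (shape i j l))
    (shapeLabel-irrelevant (rotateLabels L) (rotate (shape i j l)) (shape j l i))

  label-injective₁ : (L : Labels v X) → ∀ {i j l i′ l′} → label L i j l ≡ label L i′ j l′ → i ≡ i′ × l ≡ l′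
  label-injective₁ L {i} {j} {l} {i′} {l′} eq =
    let l≡l′ , i≡i′ = label-injective₀ (rotateLabels L) {i = j}
          (trans (sym (label-rotate L i j l)) (trans eq (label-rotate L i′ j l′)))
    in i≡i′ , l≡l′

  label-injective₂ : (L : Labels v X) → ∀ {i j l i′ j′} → label L i j l ≡ label L i′ j′ l → i ≡ i′ × j ≡ j′
  label-injective₂ L {i} {j} {l} {i′} {j′} eq =
    let j≡j′ , i≡i′ = label-injective₁ (rotateLabels L) {j = l}
          (trans (sym (label-rotate L i j l)) (trans eq (label-rotate L i′ j′ l)))
    in i≡i′ , j≡j′

-- Labels from factorisations

module _ (F₂ : Factorisation 2 v N) where
  open Factorisation F₂

  pairColour : (i j : Fin v) → i ≢ j → Fin N
  pairColour i j p = colour (pair i j) (∣pair∣ p)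

  pairColour-sym : ∀ {i j} p q → pairColour i j p ≡ pairColour j i q
  pairColour-sym {i} {j} p q = colour-cong F₂ _ _ (pair-comm i j)

  pairColour-injective : ∀ {i j j′} p q → pairColour i j p ≡ pairColour i j′ q → j ≡ j′
  pairColour-injective {i} p q eq = pair-injective p (proper _ _ (x∈⁅x⁆∪p i _) (x∈⁅x⁆∪p i _) eq)

module _ (F₃ : Factorisation 3 v M) where
  open Factorisation F₃

  tripleColour : (i j l : Fin v) → i ≢ j → j ≢ l → i ≢ l → Fin M
  tripleColour i j l p q r = colour (triple i j l) (∣triple∣ p q r)

  tripleColour-rotate : ∀ {i j l} p q r p′ q′ r′ → tripleColour i j l p q r ≡ tripleColour j l i p′ q′ r′
  tripleColour-rotate {i} {j} {l} p q r p′ q′ r′ = colour-cong F₃ _ _ (triple-rotate i j l)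

  tripleColour-injective : ∀ {i j l j′ l′} p q r p′ q′ r′ →
    tripleColour i j l p q r ≡ tripleColour i j′ l′ p′ q′ r′ → (j ≡ j′ × l ≡ l′) ⊎ (j ≡ l′ × l ≡ j′)
  tripleColour-injective {i} p q r p′ q′ r′ eq =
    triple-injective p q r (proper _ _ (x∈⁅x⁆∪p i _) (x∈⁅x⁆∪p i _) eq)

  -- Every colour class of unordered triples serves twice, once for each cyclic orientation.
  orientedColour : (i j l : Fin v) → i ≢ j → j ≢ l → i ≢ l → Fin M × Bool
  orientedColour i j l p q r = tripleColour i j l p q r , orientation i j l

  orientedColour-rotate : ∀ {i j l} p q r p′ q′ r′ → orientedColour i j l p q r ≡ orientedColour j l i p′ q′ r′
  orientedColour-rotate {i} {j} {l} p q r p′ q′ r′ =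
    cong₂ _,_ (tripleColour-rotate p q r p′ q′ r′) (orientation-rotate i j l)

  orientedColour-injective : ∀ {i j l j′ l′} p q r p′ q′ r′ →
    orientedColour i j l p q r ≡ orientedColour i j′ l′ p′ q′ r′ → j ≡ j′ × l ≡ l′
  orientedColour-injective {i} {j} {l} p q r p′ q′ r′ eq
    with tripleColour-injective p q r p′ q′ r′ (proj₁ (,-injective eq))
  ... | inj₁ same          = same
  ... | inj₂ (refl , refl) = contradiction (proj₂ (,-injective eq)) (orientation-swap i j l p q r)

labels-3∣v : Factorisation 3 v M → Factorisation 2 v N → Labels v ((Fin M × Bool) ⊎ ((Fin 3 × Fin N) ⊎ ⊤))
labels-3∣v F₃ F₂ = record
  { O = inj₂ (inj₂ tt)
  ; P = λ a i j p → inj₂ (inj₁ (a , pairColour F₂ i j p))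
  ; T = λ i j l p q r → inj₁ (orientedColour F₃ i j l p q r)
  ; P-sym = λ p q → cong (λ c → inj₂ (inj₁ (_ , c))) (pairColour-sym F₂ p q)
  ; P-injective = λ p q eq → let a≡b , same = ,-injective (inj₁-injective (inj₂-injective eq))
                             in a≡b , pairColour-injective F₂ p q same
  ; T-rotate = λ p q r p′ q′ r′ → cong inj₁ (orientedColour-rotate F₃ p q r p′ q′ r′)
  ; T-injective = λ p q r p′ q′ r′ eq → orientedColour-injective F₃ p q r p′ q′ r′ (inj₁-injective eq)
  ; O≢P = λ _ () ; O≢T = λ _ _ _ () ; P≢T = λ _ _ _ _ ()
  }

-- A point ∞ = zero is added; the pairs with two of the three types are coloured as the two
-- orientations of their union with ∞.
labels-3∣v+1 : Factorisation 3 (suc v) M → Factorisation 2 v N → Labels v ((Fin M × Bool) ⊎ (Fin N ⊎ ⊤))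
labels-3∣v+1 {v} {M} {N} F₃ F₂ = record
  { O = inj₂ (inj₂ tt)
  ; P = P
  ; T = λ i j l p q r → inj₁ (orientedColour F₃ (suc i) (suc j) (suc l) (s≢s p) (s≢s q) (s≢s r))
  ; P-sym = λ {a} → P-sym a
  ; P-injective = λ {a} {b} → P-injective a b
  ; T-rotate = λ p q r p′ q′ r′ →
      cong inj₁ (orientedColour-rotate F₃ (s≢s p) (s≢s q) (s≢s r) (s≢s p′) (s≢s q′) (s≢s r′))
  ; T-injective = λ p q r p′ q′ r′ eq →
      let j≡j′ , l≡l′ = orientedColour-injective F₃ (s≢s p) (s≢s q) (s≢s r) (s≢s p′) (s≢s q′) (s≢s r′)
                         (inj₁-injective eq)
      in Fin.suc-injective j≡j′ , Fin.suc-injective l≡l′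
  ; O≢P = λ {a} → O≢P a
  ; O≢T = λ _ _ _ ()
  ; P≢T = λ {a} → P≢T a
  }
  where
  s≢s : {i j : Fin v} → i ≢ j → suc i ≢ suc j
  s≢s i≢j = i≢j ∘ Fin.suc-injective

  ∞Colour : (i j : Fin v) → i ≢ j → Fin M
  ∞Colour i j p = tripleColour F₃ (suc i) (suc j) zero (s≢s p) (λ ()) (λ ())

  ∞Colour-sym : ∀ {i j} p q → ∞Colour i j p ≡ ∞Colour j i q
  ∞Colour-sym {i} {j} p q = colour-cong F₃ _ _
    (trans (triple-rotate (suc i) (suc j) zero) (cong (⁅ suc j ⁆ ∪_) (pair-comm zero (suc i))))

  ∞Colour-injective : ∀ {i j j′} p q → ∞Colour i j p ≡ ∞Colour i j′ q → j ≡ j′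
  ∞Colour-injective {i} {j} {j′} p q eq with tripleColour-injective F₃ {suc i} {suc j} {zero} {suc j′} {zero}
    (s≢s p) (λ ()) (λ ()) (s≢s q) (λ ()) (λ ()) eq
  ... | inj₁ (refl , _) = refl

  -- Only the first of these two triples through `suc i` contains ∞, so they differ and properness
  -- separates their colours.
  ∞Colour≢ : ∀ {i j j′ l′} p p′ q′ r′ →
             ∞Colour i j p ≢ tripleColour F₃ (suc i) (suc j′) (suc l′) (s≢s p′) (s≢s q′) (s≢s r′)
  ∞Colour≢ {i} {j} {j′} {l′} p p′ q′ r′ eq with tripleColour-injective F₃ {suc i} {suc j} {zero} {suc j′} {suc l′}
    (s≢s p) (λ ()) (λ ()) (s≢s p′) (s≢s q′) (s≢s r′) eq
  ... | inj₁ (_ , ())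
  ... | inj₂ (_ , ())

  P : Fin 3 → (i j : Fin v) → i ≢ j → (Fin M × Bool) ⊎ (Fin N ⊎ ⊤)
  P 0F i j p = inj₁ (∞Colour i j p , false)
  P 1F i j p = inj₁ (∞Colour i j p , true)
  P 2F i j p = inj₂ (inj₁ (pairColour F₂ i j p))

  P-sym : ∀ a {i j} p q → P a i j p ≡ P a j i q
  P-sym 0F p q = cong (λ c → inj₁ (c , false)) (∞Colour-sym p q)
  P-sym 1F p q = cong (λ c → inj₁ (c , true)) (∞Colour-sym p q)
  P-sym 2F p q = cong (inj₂ ∘ inj₁) (pairColour-sym F₂ p q)

  P-injective : ∀ a b {i j j′} p q → P a i j p ≡ P b i j′ q → a ≡ b × j ≡ j′
  P-injective 0F 0F p q eq = refl , ∞Colour-injective p q (proj₁ (,-injective (inj₁-injective eq)))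
  P-injective 0F 1F p q eq = contradiction (proj₂ (,-injective (inj₁-injective eq))) λ ()
  P-injective 0F 2F p q ()
  P-injective 1F 0F p q eq = contradiction (proj₂ (,-injective (inj₁-injective eq))) λ ()
  P-injective 1F 1F p q eq = refl , ∞Colour-injective p q (proj₁ (,-injective (inj₁-injective eq)))
  P-injective 1F 2F p q ()
  P-injective 2F 0F p q ()
  P-injective 2F 1F p q ()
  P-injective 2F 2F p q eq = refl , pairColour-injective F₂ p q (inj₁-injective (inj₂-injective eq))

  O≢P : ∀ a {i j} p → inj₂ (inj₂ tt) ≢ P a i j p
  O≢P 0F p ()
  O≢P 1F p ()
  O≢P 2F p ()

  P≢T : ∀ a {i j j′ l′} p p′ q′ r′ → P a i j p ≢
        inj₁ (orientedColour F₃ (suc i) (suc j′) (suc l′) (s≢s p′) (s≢s q′) (s≢s r′))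
  P≢T 0F p p′ q′ r′ eq = ∞Colour≢ p p′ q′ r′ (proj₁ (,-injective (inj₁-injective eq)))
  P≢T 1F p p′ q′ r′ eq = ∞Colour≢ p p′ q′ r′ (proj₁ (,-injective (inj₁-injective eq)))
  P≢T 2F p p′ q′ r′ ()

-- A layer has v² positions and there are v² labels, so injectivity makes every layer a bijection.
record LatinLabelling (v : ℕ) : Set where
  field
    index      : Fin v → Fin v → Fin v → Fin (v ^ 2)
    injective₀ : ∀ {i j l j′ l′} → index i j l ≡ index i j′ l′ → j ≡ j′ × l ≡ l′
    injective₁ : ∀ {i j l i′ l′} → index i j l ≡ index i′ j l′ → i ≡ i′ × l ≡ l′
    injective₂ : ∀ {i j l i′ j′} → index i j l ≡ index i′ j′ l → i ≡ i′ × j ≡ j′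
    index-cyc  : ∀ {i j l} → i ≢ j → j ≢ l → i ≢ l → index i j l ≡ index j l i
    index-iij  : ∀ i j → index i i j ≡ index j j i
    index-iji  : ∀ i j → index i j i ≡ index j i j
    index-ijj  : ∀ i j → index i j j ≡ index j i i

latinLabelling : {X : Set} → Labels v X → X ↔ Fin N → N ≡ v ^ 2 → LatinLabelling v
latinLabelling {v = v} {X} L X↔Fin refl = record
  { index = λ i j l → f (label L i j l)
  ; injective₀ = λ {i} {j} {l} {j′} {l′} eq → label-injective₀ L {i} {j} {l} {j′} {l′} (f-injective eq)
  ; injective₁ = λ {i} {j} {l} {i′} {l′} eq → label-injective₁ L {i} {j} {l} {i′} {l′} (f-injective eq)
  ; injective₂ = λ {i} {j} {l} {i′} {j′} eq → label-injective₂ L {i} {j} {l} {i′} {j′} (f-injective eq)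
  ; index-cyc = λ p q r → cong f (label-cyclic L p q r)
  ; index-iij = λ i j → cong f (label-iij L i j)
  ; index-iji = λ i j → cong f (label-iji L i j)
  ; index-ijj = λ i j → cong f (label-ijj L i j)
  }
  where
  open Injection (Inverse⇒Injection X↔Fin) using () renaming (to to f; injective to f-injective)

Fin×Bool↔ : ∀ M → (Fin M × Bool) ↔ Fin (M * 2)
Fin×Bool↔ M = ↔-trans (↔-refl ×-↔ ↔-sym 2↔Bool) (↔-sym *↔×)

⊎↔+ : {X Y : Set} → X ↔ Fin m → Y ↔ Fin n → (X ⊎ Y) ↔ Fin (m + n)
⊎↔+ f g = ↔-trans (f ⊎-↔ g) (↔-sym +↔⊎)

pairs : ∀ v′ u → suc v′ ≡ u * 2 → Factorisation 2 (suc v′) v′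
pairs v′ u v≡2u = subst (Factorisation 2 (suc v′)) (nC1≡n v′) (baranyai 1 v′ u v≡2u)

2*nC2 : ∀ n → (suc n C 2) * 2 ≡ suc n * n
2*nC2 n = trans (ℕ.*-comm (suc n C 2) 2) (trans (absorption n 1) (cong (suc n *_) (nC1≡n n)))

-- There are 2 · C(v - 1, 2) classes of oriented triples, 3 (v - 1) classes of typed pairs and one
-- class of singletons, v² in all.
labelling-3∣v : ∀ v′ t u → suc (suc v′) ≡ t * 3 → suc (suc v′) ≡ u * 2 → LatinLabelling (suc (suc v′))
labelling-3∣v v′ t u v≡3t v≡2u = latinLabelling (labels-3∣v F₃ F₂)
  (⊎↔+ (Fin×Bool↔ (suc v′ C 2)) (⊎↔+ (↔-sym (*↔× {3} {suc v′})) (↔-sym Fin.1↔⊤))) size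
  where
  F₃ : Factorisation 3 (suc (suc v′)) (suc v′ C 2)
  F₃ = baranyai 2 (suc v′) t v≡3t
  F₂ : Factorisation 2 (suc (suc v′)) (suc v′)
  F₂ = pairs (suc v′) u v≡2u
  square : ∀ x → (1 + x) * x + (3 * (1 + x) + 1) ≡ (2 + x) * ((2 + x) * 1)
  square = ℕSolver.solve-∀
  size : (suc v′ C 2) * 2 + (3 * suc v′ + 1) ≡ suc (suc v′) ^ 2
  size = trans (cong (_+ (3 * suc v′ + 1)) (2*nC2 v′)) (square v′)

-- The v + 1 points yield 2 · C(v, 2) oriented classes, the remaining type of pairs v - 1 and the
-- singletons one, again v² in all.
labelling-3∣v+1 : ∀ v′ t u → suc (suc v′) ≡ t * 3 → suc v′ ≡ u * 2 → LatinLabelling (suc v′)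
labelling-3∣v+1 v′ t u v+1≡3t v≡2u = latinLabelling (labels-3∣v+1 F₃ F₂)
  (⊎↔+ (Fin×Bool↔ (suc v′ C 2)) (⊎↔+ (↔-refl {A = Fin v′}) (↔-sym Fin.1↔⊤))) size
  where
  F₃ : Factorisation 3 (suc (suc v′)) (suc v′ C 2)
  F₃ = baranyai 2 (suc v′) t v+1≡3t
  F₂ : Factorisation 2 (suc v′) v′
  F₂ = pairs v′ u v≡2u
  square : ∀ x → (1 + x) * x + (x + 1) ≡ (1 + x) * ((1 + x) * 1)
  square = ℕSolver.solve-∀
  size : (suc v′ C 2) * 2 + (v′ + 1) ≡ suc v′ ^ 2
  size = trans (cong (_+ (v′ + 1)) (2*nC2 v′)) (square v′)

-- Sums of signs

open import Data.Integer.Base using (+_; -[1+_])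

private variable
  w : ℕ

∑ℤ-cong : {f g : Fin n → ℤ} → (∀ i → f i ≡ g i) → sumℤ f ≡ sumℤ g
∑ℤ-cong = ℤ∑.sum-cong-≗

∑ℤ-+ : (f g : Fin n → ℤ) → sumℤ (λ i → f i ℤ.+ g i) ≡ sumℤ f ℤ.+ sumℤ g
∑ℤ-+ = ℤ∑.∑-distrib-+

∑ℤ-comm : (f : Fin m → Fin n → ℤ) → sumℤ (λ i → sumℤ (f i)) ≡ sumℤ (λ j → sumℤ λ i → f i j)
∑ℤ-comm = ℤ∑.∑-comm

*-∑ℤ : ∀ x (f : Fin n → ℤ) → x ℤ.* sumℤ f ≡ sumℤ (λ i → x ℤ.* f i)
*-∑ℤ = ℤ∑*.*-distribˡ-sum

∑ℤ-* : ∀ x (f : Fin n → ℤ) → sumℤ f ℤ.* x ≡ sumℤ (λ i → f i ℤ.* x)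
∑ℤ-* = ℤ∑*.*-distribʳ-sum

+-∑ : (f : Fin n → ℕ) → + sumℕ f ≡ sumℤ (λ i → + f i)
+-∑ {zero}  f = refl
+-∑ {suc n} f = cong (λ x → + f zero ℤ.+ x) (+-∑ (f ∘ suc))

∑ℤ-const : ∀ n x → sumℤ {n} (λ _ → x) ≡ + n ℤ.* x
∑ℤ-const zero    x = refl
∑ℤ-const (suc n) x = trans (cong (λ y → x ℤ.+ y) (∑ℤ-const n x)) (sym (ℤ.suc-* (+ n) x))

∑ℤ-zero : (f : Fin n → ℤ) → (∀ i → f i ≡ 0ℤ) → sumℤ f ≡ 0ℤ
∑ℤ-zero {n} f f≡0 = trans (∑ℤ-cong f≡0) (ℤ∑.sum-replicate-zero n)

∑ℤ-single : (i : Fin n) (f : Fin n → ℤ) → (∀ j → i ≢ j → f j ≡ 0ℤ) → sumℤ f ≡ f i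
∑ℤ-single zero    f f≡0 = trans (cong (λ x → f zero ℤ.+ x) (∑ℤ-zero (f ∘ suc) λ j → f≡0 (suc j) λ ())) (ℤ.+-identityʳ _)
∑ℤ-single (suc i) f f≡0 = trans (cong₂ ℤ._+_ (f≡0 zero λ ())
  (∑ℤ-single i (f ∘ suc) λ j i≢j → f≡0 (suc j) (i≢j ∘ Fin.suc-injective))) (ℤ.+-identityˡ _)

∑ℤ-↑ : ∀ m {k} (f : Fin (m + k) → ℤ) → sumℤ f ≡ sumℤ (λ i → f (i ↑ˡ k)) ℤ.+ sumℤ (λ i → f (m ↑ʳ i))
∑ℤ-↑ zero    f = sym (ℤ.+-identityˡ _)
∑ℤ-↑ (suc m) f = trans (cong (λ y → f zero ℤ.+ y) (∑ℤ-↑ m (f ∘ suc))) (sym (ℤ.+-assoc (f zero) _ _))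

∑ℤ-combine : ∀ m k (f : Fin (m * k) → ℤ) → sumℤ f ≡ sumℤ (λ i → sumℤ λ a → f (combine {m} {k} i a))
∑ℤ-combine zero    k f = refl
∑ℤ-combine (suc m) k f = trans (∑ℤ-↑ k f)
  (cong (λ y → sumℤ (λ a → f (a ↑ˡ (m * k))) ℤ.+ y) (∑ℤ-combine m k (λ x → f (k ↑ʳ x))))

∑∑ℤ-product : ∀ x (f : Fin m → ℤ) (g : Fin n → ℤ) →
  sumℤ (λ b → sumℤ λ c → x ℤ.* (f b ℤ.* g c)) ≡ x ℤ.* (sumℤ f ℤ.* sumℤ g)
∑∑ℤ-product x f g = sym (begin
  x ℤ.* (sumℤ f ℤ.* sumℤ g)                    ≡⟨ cong (x ℤ.*_) (∑ℤ-* (sumℤ g) f) ⟩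
  x ℤ.* sumℤ (λ b → f b ℤ.* sumℤ g)            ≡⟨ *-∑ℤ x (λ b → f b ℤ.* sumℤ g) ⟩
  sumℤ (λ b → x ℤ.* (f b ℤ.* sumℤ g))          ≡⟨ ∑ℤ-cong (λ b → trans
    (cong (x ℤ.*_) (*-∑ℤ (f b) g)) (*-∑ℤ x (λ c → f b ℤ.* g c))) ⟩
  sumℤ (λ b → sumℤ λ c → x ℤ.* (f b ℤ.* g c))  ∎)
  where open ≡-Reasoning

injective⇒hits≤1 : (σ : Fin m → Fin n) → (∀ {x y} → σ x ≡ σ y → x ≡ y) → ∀ p → sumℕ (λ x → 𝟙 (σ x Fin.≟ p)) ≤ 1
injective⇒hits≤1 {zero}  σ σ-inj p = z≤n
injective⇒hits≤1 {suc m} σ σ-inj p with σ zero Fin.≟ p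
... | no  _    = injective⇒hits≤1 (σ ∘ suc) (Fin.suc-injective ∘ σ-inj) p
... | yes refl = s≤s (ℕ.≤-reflexive (trans
  (sum-cong λ x → cong (λ b → if b then 1 else 0) (dec-false (σ (suc x) Fin.≟ p) λ eq → case σ-inj eq of λ ()))
  (trans (sum-const m 0) (ℕ.*-zeroʳ m))))

-- Every `p` is hit at most once and there are `n` hits altogether, so each `p` is hit exactly once.
∑ℤ-reindex : m ≡ n → (σ : Fin m → Fin n) → (∀ {x y} → σ x ≡ σ y → x ≡ y) → (f : Fin n → ℤ) →
             sumℤ (λ x → f (σ x)) ≡ sumℤ f
∑ℤ-reindex {m} {n} m≡n σ σ-inj f = begin
  sumℤ (λ x → f (σ x))                                  ≡⟨ ∑ℤ-cong (λ x → sym (delta x)) ⟩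
  sumℤ (λ x → sumℤ λ p → + 𝟙 (σ x Fin.≟ p) ℤ.* f p)     ≡⟨ ∑ℤ-comm {m} {n} _ ⟩
  sumℤ (λ p → sumℤ λ x → + 𝟙 (σ x Fin.≟ p) ℤ.* f p)     ≡⟨ ∑ℤ-cong (λ p → begin
    sumℤ (λ x → + 𝟙 (σ x Fin.≟ p) ℤ.* f p)    ≡⟨ ∑ℤ-* (f p) (λ x → + 𝟙 (σ x Fin.≟ p)) ⟨
    sumℤ (λ x → + 𝟙 (σ x Fin.≟ p)) ℤ.* f p    ≡⟨ cong (ℤ._* f p) (+-∑ (λ x → 𝟙 (σ x Fin.≟ p))) ⟨
    + sumℕ (λ x → 𝟙 (σ x Fin.≟ p)) ℤ.* f p    ≡⟨ cong (λ c → + c ℤ.* f p) (once p) ⟩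
    1ℤ ℤ.* f p                                ≡⟨ ℤ.*-identityˡ (f p) ⟩
    f p                                       ∎) ⟩
  sumℤ f ∎
  where
  open ≡-Reasoning
  delta : ∀ x → sumℤ (λ p → + 𝟙 (σ x Fin.≟ p) ℤ.* f p) ≡ f (σ x)
  delta x = trans
    (∑ℤ-single (σ x) _ λ p σx≢p → cong (λ b → + (if b then 1 else 0) ℤ.* f p) (dec-false (σ x Fin.≟ p) σx≢p))
    (trans (cong (λ b → + (if b then 1 else 0) ℤ.* f (σ x)) (dec-true (σ x Fin.≟ σ x) refl)) (ℤ.*-identityˡ _))
  total : n * 1 ≡ sumℕ (λ p → sumℕ λ x → 𝟙 (σ x Fin.≟ p))
  total = begin
    n * 1                                           ≡⟨ cong (_* 1) m≡n ⟨
    m * 1                                           ≡⟨ sum-const m 1 ⟨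
    sumℕ {m} (λ _ → 1)                              ≡⟨ sum-cong (λ x → sum-δ (σ x) (λ _ → 1)) ⟨
    sumℕ (λ x → sumℕ λ p → 𝟙 (σ x Fin.≟ p) * 1)     ≡⟨ ∑∑-cong {m} {n} (λ x p → ℕ.*-identityʳ _) ⟩
    sumℕ (λ x → sumℕ λ p → 𝟙 (σ x Fin.≟ p))         ≡⟨ sum-comm {m} {n} _ ⟩
    sumℕ (λ p → sumℕ λ x → 𝟙 (σ x Fin.≟ p))         ∎
  once : ∀ p → sumℕ (λ x → 𝟙 (σ x Fin.≟ p)) ≡ 1
  once = sum-≡⇒≗ _ (λ _ → 1) (injective⇒hits≤1 σ σ-inj)
    (ℕ.≤-reflexive (trans (sum-const n 1) total))

∑∑ℤ-reindex : (σ : Fin v → Fin v → Fin (v ^ 2)) → (∀ {j l j′ l′} → σ j l ≡ σ j′ l′ → j ≡ j′ × l ≡ l′) →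
              (f : Fin (v ^ 2) → ℤ) → sumℤ (λ j → sumℤ λ l → f (σ j l)) ≡ sumℤ f
∑∑ℤ-reindex {v} σ σ-inj f = begin
  sumℤ (λ j → sumℤ λ l → f (σ j l))
    ≡⟨ ∑ℤ-cong (λ j → ∑ℤ-cong λ l → cong (f ∘ uncurry σ) (remQuot-combine {v} {v} j l)) ⟨
  sumℤ (λ j → sumℤ λ l → f (uncurry σ (remQuot {v} v (combine {v} {v} j l))))
    ≡⟨ ∑ℤ-combine v v (λ x → f (uncurry σ (remQuot {v} v x))) ⟨
  sumℤ (λ x → f (uncurry σ (remQuot {v} v x)))
    -- `v ^ 2` unfolds to `v * (v * 1)`, whereas the pairs are numbered by `v * v`.
    ≡⟨ ∑ℤ-reindex (cong (v *_) (sym (ℕ.*-identityʳ v))) (λ x → uncurry σ (remQuot {v} v x)) flat-inj f ⟩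
  sumℤ f ∎
  where
  open ≡-Reasoning
  flat-inj : ∀ {x y} → uncurry σ (remQuot {v} v x) ≡ uncurry σ (remQuot {v} v y) → x ≡ y
  flat-inj {x} {y} eq = trans (sym (combine-remQuot {v} v x)) (trans
    (uncurry (cong₂ combine) (σ-inj eq)) (combine-remQuot {v} v y))

-- Passing between signs and bits

IsSign : ℤ → Set
IsSign z = z ≡ 1ℤ ⊎ z ≡ -1ℤ

sign-* : ∀ {x y} → IsSign x → IsSign y → IsSign (x ℤ.* y)
sign-* (inj₁ refl) (inj₁ refl) = inj₁ refl
sign-* (inj₁ refl) (inj₂ refl) = inj₂ refl
sign-* (inj₂ refl) (inj₁ refl) = inj₂ refl
sign-* (inj₂ refl) (inj₂ refl) = inj₁ refl

sign² : ∀ {x} → IsSign x → x ℤ.* x ≡ 1ℤ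
sign² (inj₁ refl) = refl
sign² (inj₂ refl) = refl

-- The sign -1 becomes a one and 1 a zero, so a layer with positive sum has fewer ones than zeros.
bit : ℤ → Fin 2
bit (+ _)    = 0F
bit -[1+ _ ] = 1F

±1 : Fin 2 → ℤ
±1 0F = 1ℤ
±1 1F = -1ℤ

±1-bit : ∀ {z} → IsSign z → ±1 (bit z) ≡ z
±1-bit (inj₁ refl) = refl
±1-bit (inj₂ refl) = refl

∑∑ : (Fin w → Fin w → ℤ) → ℤ
∑∑ f = sumℤ λ y → sumℤ (f y)

∑∑-+ : (f g : Fin w → Fin w → ℤ) → ∑∑ (λ y z → f y z ℤ.+ g y z) ≡ ∑∑ f ℤ.+ ∑∑ g
∑∑-+ f g = trans (∑ℤ-cong λ y → ∑ℤ-+ (f y) (g y)) (∑ℤ-+ (λ y → sumℤ (f y)) (λ y → sumℤ (g y)))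

∑∑-* : ∀ x (f : Fin w → Fin w → ℤ) → ∑∑ (λ y z → x ℤ.* f y z) ≡ x ℤ.* ∑∑ f
∑∑-* x f = sym (trans (*-∑ℤ x (λ y → sumℤ (f y))) (∑ℤ-cong λ y → *-∑ℤ x (f y)))

∑∑-1 : ∀ w → ∑∑ {w} (λ _ _ → 1ℤ) ≡ + (w * w)
∑∑-1 w = trans (∑ℤ-cong {w} λ _ → trans (∑ℤ-const w 1ℤ) (ℤ.*-identityʳ (+ w)))
  (trans (∑ℤ-const w (+ w)) (sym (ℤ.pos-* w w)))

+-∑∑ : (f : Fin w → Fin w → ℕ) → + sumℕ (λ y → sumℕ (f y)) ≡ ∑∑ (λ y z → + f y z)
+-∑∑ f = trans (+-∑ (λ y → sumℕ (f y))) (∑ℤ-cong λ y → +-∑ (f y))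

-- A bit b with sign e satisfies 2b + e = 1; this is summed over the layer.
ones-from-sum : ∀ {s} (L : Matrix (Fin 2) w) → ∑∑ (λ y z → ±1 (L y z)) ≡ + s → #ones L * 2 + s ≡ w * w
ones-from-sum {w} {s} L ∑L≡s = ℤ.+-injective (begin
  + (#ones L * 2 + s)
    ≡⟨ ℤ.pos-+ (#ones L * 2) s ⟩
  + (#ones L * 2) ℤ.+ + s
    ≡⟨ cong₂ ℤ._+_ (trans (ℤ.pos-* (#ones L) 2) (ℤ.*-comm (+ #ones L) (+ 2))) (sym ∑L≡s) ⟩
  + 2 ℤ.* + #ones L ℤ.+ ∑∑ (λ y z → ±1 (L y z))
    ≡⟨ cong (λ x → + 2 ℤ.* x ℤ.+ ∑∑ (λ y z → ±1 (L y z))) (+-∑∑ (λ y z → 𝟙 (L y z Fin.≟ 1F))) ⟩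
  + 2 ℤ.* ∑∑ (λ y z → + 𝟙 (L y z Fin.≟ 1F)) ℤ.+ ∑∑ (λ y z → ±1 (L y z))
    ≡⟨ cong (ℤ._+ ∑∑ (λ y z → ±1 (L y z))) (∑∑-* (+ 2) (λ y z → + 𝟙 (L y z Fin.≟ 1F))) ⟨
  ∑∑ (λ y z → + 2 ℤ.* + 𝟙 (L y z Fin.≟ 1F)) ℤ.+ ∑∑ (λ y z → ±1 (L y z))
    ≡⟨ ∑∑-+ (λ y z → + 2 ℤ.* + 𝟙 (L y z Fin.≟ 1F)) (λ y z → ±1 (L y z)) ⟨
  ∑∑ (λ y z → + 2 ℤ.* + 𝟙 (L y z Fin.≟ 1F) ℤ.+ ±1 (L y z))
    ≡⟨ ∑ℤ-cong (λ y → ∑ℤ-cong λ z → pointwise (L y z)) ⟩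
  ∑∑ {w} (λ _ _ → 1ℤ)
    ≡⟨ ∑∑-1 w ⟩
  + (w * w) ∎)
  where
  open ≡-Reasoning
  pointwise : ∀ t → + 2 ℤ.* + 𝟙 (t Fin.≟ 1F) ℤ.+ ±1 t ≡ 1ℤ
  pointwise 0F = refl
  pointwise 1F = refl

-- From e = 1 - 2b and e′ = 1 - 2b′ follows 4bb′ + e + e′ = 1 + ee′; this is summed over all
-- positions.
scalarProduct-from-sums : ∀ {s} (L M : Matrix (Fin 2) w) →
  ∑∑ (λ y z → ±1 (L y z)) ≡ + s → ∑∑ (λ y z → ±1 (M y z)) ≡ + s →
  ∑∑ (λ y z → ±1 (L y z) ℤ.* ±1 (M y z)) ≡ 0ℤ → scalarProduct L M * 4 + (s + s) ≡ w * w
scalarProduct-from-sums {w} {s} L M ∑L≡s ∑M≡s ∑LM≡0 = ℤ.+-injective (begin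
  + (scalarProduct L M * 4 + (s + s))
    ≡⟨ ℤ.pos-+ (scalarProduct L M * 4) (s + s) ⟩
  + (scalarProduct L M * 4) ℤ.+ + (s + s)
    ≡⟨ cong₂ ℤ._+_ (trans (ℤ.pos-* (scalarProduct L M) 4) (ℤ.*-comm (+ scalarProduct L M) (+ 4)))
         (trans (ℤ.pos-+ s s) (cong₂ ℤ._+_ (sym ∑L≡s) (sym ∑M≡s))) ⟩
  + 4 ℤ.* + scalarProduct L M ℤ.+ (∑∑ e ℤ.+ ∑∑ e′)
    ≡⟨ cong₂ ℤ._+_ (trans (cong (+ 4 ℤ.*_) (+-∑∑ both)) (sym (∑∑-* (+ 4) (λ y z → + both y z)))) (sym (∑∑-+ e e′)) ⟩
  ∑∑ (λ y z → + 4 ℤ.* + both y z) ℤ.+ ∑∑ (λ y z → e y z ℤ.+ e′ y z)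
    ≡⟨ ∑∑-+ (λ y z → + 4 ℤ.* + both y z) (λ y z → e y z ℤ.+ e′ y z) ⟨
  ∑∑ (λ y z → + 4 ℤ.* + both y z ℤ.+ (e y z ℤ.+ e′ y z))
    ≡⟨ ∑ℤ-cong (λ y → ∑ℤ-cong λ z → pointwise (L y z) (M y z)) ⟩
  ∑∑ (λ y z → 1ℤ ℤ.+ e y z ℤ.* e′ y z)
    ≡⟨ ∑∑-+ (λ _ _ → 1ℤ) (λ y z → e y z ℤ.* e′ y z) ⟩
  ∑∑ {w} (λ _ _ → 1ℤ) ℤ.+ ∑∑ (λ y z → e y z ℤ.* e′ y z)
    ≡⟨ cong₂ ℤ._+_ (∑∑-1 w) ∑LM≡0 ⟩
  + (w * w) ℤ.+ 0ℤ
    ≡⟨ ℤ.+-identityʳ _ ⟩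
  + (w * w) ∎)
  where
  open ≡-Reasoning
  e e′ : Fin w → Fin w → ℤ
  e y z = ±1 (L y z)
  e′ y z = ±1 (M y z)
  both : Fin w → Fin w → ℕ
  both y z = toℕ (L y z) * toℕ (M y z)
  pointwise : ∀ t u → + 4 ℤ.* + (toℕ t * toℕ u) ℤ.+ (±1 t ℤ.+ ±1 u) ≡ 1ℤ ℤ.+ ±1 t ℤ.* ±1 u
  pointwise 0F 0F = refl
  pointwise 0F 1F = refl
  pointwise 1F 0F = refl
  pointwise 1F 1F = refl

-- From labellings and Hadamard matrices to cubes

norm² : {f : Fin n → ℤ} → (∀ i → IsSign (f i)) → sumℤ (λ i → f i ℤ.* f i) ≡ + n
norm² {n} signs = trans (∑ℤ-cong λ i → sign² (signs i)) (trans (∑ℤ-const n 1ℤ) (ℤ.*-identityʳ (+ n)))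

∑∑-combine : (f : Fin (v * n) → Fin (v * n) → ℤ) →
  ∑∑ f ≡ sumℤ λ j → sumℤ λ l → sumℤ λ b → sumℤ λ c → f (combine {v} {n} j b) (combine {v} {n} l c)
∑∑-combine {v} {n} f = begin
  ∑∑ f
    ≡⟨ ∑ℤ-combine v n (λ y → sumℤ (f y)) ⟩
  sumℤ (λ j → sumℤ λ b → sumℤ (f (combine {v} {n} j b)))
    ≡⟨ ∑ℤ-cong {v} (λ j → ∑ℤ-cong {n} λ b → ∑ℤ-combine v n (f (combine {v} {n} j b))) ⟩
  sumℤ (λ j → sumℤ λ b → sumℤ λ l → sumℤ λ c → f (combine {v} {n} j b) (combine {v} {n} l c))
    ≡⟨ ∑ℤ-cong {v} (λ j → ∑ℤ-comm {n} {v} λ b l → sumℤ λ c → f (combine {v} {n} j b) (combine {v} {n} l c)) ⟩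
  sumℤ (λ j → sumℤ λ l → sumℤ λ b → sumℤ λ c → f (combine {v} {n} j b) (combine {v} {n} l c)) ∎
  where open ≡-Reasoning

-- Only one direction is treated. An entry is a product of three factors, one for each coordinate,
-- so permuting the coordinates of `idx` and `A` gives the other two directions.
module Layers {v s : ℕ} (h : Matrix ℤ (v ^ 2)) (hadamard : IsHadamard (v ^ 2) h)
  (layer-sum : ∀ a → sumℤ (λ p → h p a ℤ.* (sumℤ (h p) ℤ.* sumℤ (h p))) ≡ + s)
  (idx : Fin v → Fin v → Fin v → Fin (v ^ 2))
  (idx-layer : ∀ {i j l j′ l′} → idx i j l ≡ idx i j′ l′ → j ≡ j′ × l ≡ l′)
  (idx-line : ∀ {i i′ j l} → idx i j l ≡ idx i′ j l → i ≡ i′)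
  (A : Fin (v ^ 3) → Matrix (Fin 2) (v ^ 3))
  (A≡ : ∀ i a j b l c → ±1 (A (combine i a) (combine j b) (combine l c)) ≡
        h (idx i j l) a ℤ.* (h (idx i j l) b ℤ.* h (idx i j l) c)) where

  open IsHadamard hadamard
  open ≡-Reasoning

  private v² = v ^ 2

  sum-layer : ∀ i a → ∑∑ (λ y z → ±1 (A (combine {v} {v²} i a) y z)) ≡ + s
  sum-layer i a = begin
    ∑∑ (λ y z → ±1 (A (combine {v} {v²} i a) y z))
      ≡⟨ ∑∑-combine {v} {v²} (λ y z → ±1 (A (combine {v} {v²} i a) y z)) ⟩
    sumℤ (λ j → sumℤ λ l → sumℤ λ b → sumℤ λ c →
      ±1 (A (combine {v} {v²} i a) (combine {v} {v²} j b) (combine {v} {v²} l c)))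
      -- Block (j, l) of the layer is the outer product of row `idx i j l` with itself, scaled by
      -- its entry at `a`; by bijectivity the labels then run through all rows.
      ≡⟨ ∑ℤ-cong {v} (λ j → ∑ℤ-cong {v} λ l → trans (∑ℤ-cong {v²} λ b → ∑ℤ-cong {v²} λ c → A≡ i a j b l c)
           (∑∑ℤ-product (h (idx i j l) a) (h (idx i j l)) (h (idx i j l)))) ⟩
    sumℤ (λ j → sumℤ λ l → G (idx i j l))
      ≡⟨ ∑∑ℤ-reindex (idx i) idx-layer G ⟩
    sumℤ G
      ≡⟨ layer-sum a ⟩
    + s ∎
    where
    G : Fin v² → ℤ
    G p = h p a ℤ.* (sumℤ (h p) ℤ.* sumℤ (h p))

  product-layers : ∀ i a i′ a′ → (i ≡ i′ → a ≢ a′) →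
    ∑∑ (λ y z → ±1 (A (combine {v} {v²} i a) y z) ℤ.* ±1 (A (combine {v} {v²} i′ a′) y z)) ≡ 0ℤ
  product-layers i a i′ a′ distinct = begin
    ∑∑ (λ y z → ±1 (A (combine {v} {v²} i a) y z) ℤ.* ±1 (A (combine {v} {v²} i′ a′) y z))
      ≡⟨ ∑∑-combine {v} {v²} (λ y z → ±1 (A (combine {v} {v²} i a) y z) ℤ.* ±1 (A (combine {v} {v²} i′ a′) y z)) ⟩
    sumℤ (λ j → sumℤ λ l → sumℤ λ b → sumℤ λ c →
      ±1 (A (combine {v} {v²} i a) (combine {v} {v²} j b) (combine {v} {v²} l c)) ℤ.*
      ±1 (A (combine {v} {v²} i′ a′) (combine {v} {v²} j b) (combine {v} {v²} l c)))
      ≡⟨ ∑ℤ-cong {v} (λ j → ∑ℤ-cong {v} λ l → block-product (idx i j l) (idx i′ j l) j l refl refl) ⟩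
    sumℤ (λ j → sumℤ λ l → G (idx i j l) (idx i′ j l))
      ≡⟨ by-blocks (i Fin.≟ i′) ⟩
    0ℤ ∎
    where
    -- The contribution of a block depends only on its two labels and contains the squared inner
    -- product of the two rows, which vanishes for distinct labels.
    G : Fin v² → Fin v² → ℤ
    G p p′ = (h p a ℤ.* h p′ a′) ℤ.* (sumℤ (λ b → h p b ℤ.* h p′ b) ℤ.* sumℤ (λ b → h p b ℤ.* h p′ b))

    regroup : ∀ x y z x′ y′ z′ →
              (x ℤ.* (y ℤ.* z)) ℤ.* (x′ ℤ.* (y′ ℤ.* z′)) ≡ (x ℤ.* x′) ℤ.* ((y ℤ.* y′) ℤ.* (z ℤ.* z′))
    regroup = ℤSolver.solve-∀

    block-product : ∀ p p′ j l → p ≡ idx i j l → p′ ≡ idx i′ j l → sumℤ (λ b → sumℤ λ c →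
      ±1 (A (combine {v} {v²} i a) (combine {v} {v²} j b) (combine {v} {v²} l c)) ℤ.*
      ±1 (A (combine {v} {v²} i′ a′) (combine {v} {v²} j b) (combine {v} {v²} l c))) ≡ G p p′
    block-product p p′ j l refl refl = trans
      (∑ℤ-cong {v²} λ b → ∑ℤ-cong {v²} λ c → trans (cong₂ ℤ._*_ (A≡ i a j b l c) (A≡ i′ a′ j b l c))
        (regroup (h p a) (h p b) (h p c) (h p′ a′) (h p′ b) (h p′ c)))
      (∑∑ℤ-product (h p a ℤ.* h p′ a′) (λ b → h p b ℤ.* h p′ b) (λ b → h p b ℤ.* h p′ b))

    by-blocks : Dec (i ≡ i′) → sumℤ (λ j → sumℤ λ l → G (idx i j l) (idx i′ j l)) ≡ 0ℤ
    by-blocks (no i≢i′) = ∑ℤ-zero {v} _ λ j → ∑ℤ-zero {v} _ λ l →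
      vanish (idx i j l) (idx i′ j l) (i≢i′ ∘ idx-line {i} {i′} {j} {l})
      where
      vanish : ∀ p p′ → p ≢ p′ → G p p′ ≡ 0ℤ
      vanish p p′ p≢p′ = trans (cong (λ x → (h p a ℤ.* h p′ a′) ℤ.* (x ℤ.* x)) (rows p p′ p≢p′))
        (ℤ.*-zeroʳ (h p a ℤ.* h p′ a′))
    -- A row has inner product v² with itself, so apart from the constant v⁴ the inner product of
    -- columns `a` and `a′` remains.
    by-blocks (yes refl) = begin
      sumℤ (λ j → sumℤ λ l → G (idx i j l) (idx i j l))
        ≡⟨ ∑∑ℤ-reindex (idx i) idx-layer (λ p → G p p) ⟩
      sumℤ (λ p → G p p)
        ≡⟨ ∑ℤ-cong {v²} (λ p → cong (λ x → (h p a ℤ.* h p a′) ℤ.* (x ℤ.* x)) (norm² (entries p))) ⟩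
      sumℤ (λ p → (h p a ℤ.* h p a′) ℤ.* (+ v² ℤ.* + v²))
        ≡⟨ ∑ℤ-* (+ v² ℤ.* + v²) (λ p → h p a ℤ.* h p a′) ⟨
      sumℤ (λ p → h p a ℤ.* h p a′) ℤ.* (+ v² ℤ.* + v²)
        ≡⟨ cong (ℤ._* (+ v² ℤ.* + v²)) (columns a a′ (distinct refl)) ⟩
      0ℤ ℤ.* (+ v² ℤ.* + v²)
        ≡⟨ ℤ.*-zeroˡ (+ v² ℤ.* + v²) ⟩
      0ℤ ∎

  layer-ones : ∀ x → #ones (A x) * 2 + s ≡ v ^ 3 * v ^ 3
  layer-ones x = subst (λ x → #ones (A x) * 2 + s ≡ v ^ 3 * v ^ 3) (combine-remQuot {v} v² x)
    (uncurry (λ i a → ones-from-sum (A (combine {v} {v²} i a)) (sum-layer i a)) (remQuot {v} v² x))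

  layer-parallel : ∀ x y → x ≢ y → scalarProduct (A x) (A y) * 4 + (s + s) ≡ v ^ 3 * v ^ 3
  layer-parallel x y x≢y = subst₂ (λ x y → scalarProduct (A x) (A y) * 4 + (s + s) ≡ v ^ 3 * v ^ 3)
    (combine-remQuot {v} v² x) (combine-remQuot {v} v² y)
    (uncurry (λ i a → uncurry (λ i′ a′ distinct →
        scalarProduct-from-sums (A (combine {v} {v²} i a)) (A (combine {v} {v²} i′ a′))
          (sum-layer i a) (sum-layer i′ a′) (product-layers i a i′ a′ distinct))
      (remQuot {v} v² y)) (remQuot {v} v² x)
      λ i≡i′ a≡a′ → x≢y (trans (sym (combine-remQuot {v} v² x))
        (trans (cong₂ (combine {v} {v²}) i≡i′ a≡a′) (combine-remQuot {v} v² y))))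

module _ (L : LatinLabelling v) (h : Matrix ℤ (v ^ 2)) where
  open LatinLabelling L

  private v² = v ^ 2

  entry : Fin v × Fin v² → Fin v × Fin v² → Fin v × Fin v² → ℤ
  entry (i , a) (j , b) (l , c) = h (index i j l) a ℤ.* (h (index i j l) b ℤ.* h (index i j l) c)

  cube : Array³ (Fin 2) (v ^ 3)
  cube x y z = bit (entry (remQuot {v} v² x) (remQuot {v} v² y) (remQuot {v} v² z))

  cube-combine : ∀ i a j b l c →
    cube (combine {v} {v²} i a) (combine {v} {v²} j b) (combine {v} {v²} l c) ≡ bit (entry (i , a) (j , b) (l , c))
  cube-combine i a j b l c = trans
    (cong (λ x → bit (entry x (remQuot {v} v² (combine {v} {v²} j b)) (remQuot {v} v² (combine {v} {v²} l c))))
          (remQuot-combine {v} {v²} i a))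
    (cong₂ (λ y z → bit (entry (i , a) y z)) (remQuot-combine {v} {v²} j b) (remQuot-combine {v} {v²} l c))

  cube-blockSymmetric : IsBlockSymmetric v cube
  cube-blockSymmetric = record
    { cyclic = λ i j l p q r → (λ a b c → same i j l j l i (index-cyc p q r) a b c)
                             , (λ a b c → same j l i l i j (index-cyc q (r ∘ sym) (p ∘ sym)) a b c)
    ; iij = λ i j → same i i j j j i (index-iij i j)
    ; iji = λ i j → same i j i j i j (index-iji i j)
    ; ijj = λ i j → same i j j j i i (index-ijj i j)
    }
    where
    same : ∀ i j l i′ j′ l′ → index i j l ≡ index i′ j′ l′ → block {v = v} cube i j l ≐ block {v = v} cube i′ j′ l′
    same i j l i′ j′ l′ eq a b c = trans (cube-combine i a j b l c) (trans
      (cong (λ p → bit (h p a ℤ.* (h p b ℤ.* h p c))) eq)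
      (sym (cube-combine i′ a j′ b l′ c)))

  module _ {s : ℕ} (hadamard : IsHadamard v² h)
    (layer-sum : ∀ a → sumℤ (λ p → h p a ℤ.* (sumℤ (h p) ℤ.* sumℤ (h p))) ≡ + s) where
    open IsHadamard hadamard

    ±1-cube : ∀ i a j b l c →
      ±1 (cube (combine {v} {v²} i a) (combine {v} {v²} j b) (combine {v} {v²} l c)) ≡ entry (i , a) (j , b) (l , c)
    ±1-cube i a j b l c = trans (cong ±1 (cube-combine i a j b l c))
      (±1-bit (sign-* (entries p a) (sign-* (entries p b) (entries p c))))
      where p = index i j l

    module L₀ = Layers {v} h hadamard layer-sum index
      (λ {i} {j} {l} {j′} {l′} → injective₀ {i} {j} {l} {j′} {l′})
      (λ {i} {i′} {j} {l} → proj₁ ∘ injective₁ {i} {j} {l} {i′} {l})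
      cube ±1-cube
    module L₁ = Layers {v} h hadamard layer-sum (λ j i l → index i j l)
      (λ {j} {i} {l} {i′} {l′} → injective₁ {i} {j} {l} {i′} {l′})
      (λ {j} {j′} {i} {l} → proj₁ ∘ injective₀ {i} {j} {l} {j′} {l})
      (λ y x z → cube x y z)
      (λ j b i a l c → trans (±1-cube i a j b l c)
        (ℤ*.x∙yz≈y∙xz (h (index i j l) a) (h (index i j l) b) (h (index i j l) c)))
    module L₂ = Layers {v} h hadamard layer-sum (λ l i j → index i j l)
      (λ {l} {i} {j} {i′} {j′} → injective₂ {i} {j} {l} {i′} {j′})
      (λ {l} {l′} {i} {j} → proj₂ ∘ injective₀ {i} {j} {l} {j} {l′})
      (λ z x y → cube x y z)
      (λ l c i a j b → trans (±1-cube i a j b l c)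
        (ℤ*.x∙yz≈z∙xy (h (index i j l) a) (h (index i j l) b) (h (index i j l) c)))

    #ones-cube : ∀ d x → #ones (layer cube d x) * 2 + s ≡ v ^ 3 * v ^ 3
    #ones-cube 0F = L₀.layer-ones
    #ones-cube 1F = L₁.layer-ones
    #ones-cube 2F = L₂.layer-ones

    scalarProduct-cube : ∀ d x y → x ≢ y → scalarProduct (layer cube d x) (layer cube d y) * 4 + (s + s) ≡ v ^ 3 * v ^ 3
    scalarProduct-cube 0F = L₀.layer-parallel
    scalarProduct-cube 1F = L₁.layer-parallel
    scalarProduct-cube 2F = L₂.layer-parallel

    -- A layer has st entries and sum s, so k = (st - s)/2 and λ = (st - 2s)/4. Both quotients are
    -- exact, being actual counts.
    blockSymmetricCube : ∀ t → s * t ≡ v ^ 3 * v ^ 3 → BlockSymmetricCube v (s * (t ∸ 1) / 2) (s * (t ∸ 2) / 4)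
    blockSymmetricCube t st≡w² = cube , record
      { ones     = λ d x → exact 2 (#ones (layer cube d x)) 1
          (trans (cong (λ y → #ones (layer cube d x) * 2 + y) (ℕ.*-identityʳ s)) (trans (#ones-cube d x) (sym st≡w²)))
      ; parallel = λ d x y x≢y → exact 4 (scalarProduct (layer cube d x) (layer cube d y)) 2
          (trans (cong (λ z → scalarProduct (layer cube d x) (layer cube d y) * 4 + z) (twice s))
            (trans (scalarProduct-cube d x y x≢y) (sym st≡w²)))
      } , cube-blockSymmetric
      where
      twice : ∀ s → s * 2 ≡ s + s
      twice s = trans (ℕ.*-comm s 2) (cong (λ x → s + x) (ℕ.+-identityʳ s))
      exact : ∀ q .{{_ : NonZero q}} x r → x * q + s * r ≡ s * t → x ≡ s * (t ∸ r) / q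
      exact q x r eq = sym (trans (cong (_/ q) (begin
        s * (t ∸ r)             ≡⟨ ℕ.*-distribˡ-∸ s t r ⟩
        s * t ∸ s * r           ≡⟨ cong (_∸ s * r) eq ⟨
        x * q + s * r ∸ s * r   ≡⟨ ℕ.m+n∸n≡m (x * q) (s * r) ⟩
        x * q                   ∎)) (m*n/n≡m x q))
        where open ≡-Reasoning

-- Scalings and line sums of Hadamard matrices

scaleColumns : {H : Matrix ℤ n} (u : Fin n → ℤ) → (∀ a → IsSign (u a)) →
               IsHadamard n H → IsHadamard n (λ p a → H p a ℤ.* u a)
scaleColumns {n} {H} u u-sign hadamard = record
  { entries = λ p a → sign-* (entries p a) (u-sign a)
  ; rows    = λ p q p≢q → trans (∑ℤ-cong {n} λ a → cancel-sign (H p a) (H q a) (u-sign a)) (rows p q p≢q)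
  -- In products of rows the column signs square to 1; in products of columns they come out as a
  -- common factor.
  ; columns = λ a b a≢b → trans (∑ℤ-cong {n} λ p → interchange (H p a) (u a) (H p b) (u b))
      (trans (sym (*-∑ℤ (u a ℤ.* u b) (λ p → H p a ℤ.* H p b)))
        (trans (cong ((u a ℤ.* u b) ℤ.*_) (columns a b a≢b)) (ℤ.*-zeroʳ (u a ℤ.* u b))))
  }
  where
  open IsHadamard hadamard
  interchange : ∀ x y z w → (x ℤ.* y) ℤ.* (z ℤ.* w) ≡ (y ℤ.* w) ℤ.* (x ℤ.* z)
  interchange = ℤSolver.solve-∀
  cancel-sign : ∀ x y {e} → IsSign e → (x ℤ.* e) ℤ.* (y ℤ.* e) ≡ x ℤ.* y
  cancel-sign x y {e} e-sign = trans (interchange x e y e)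
    (trans (cong (ℤ._* (x ℤ.* y)) (sign² e-sign)) (ℤ.*-identityˡ (x ℤ.* y)))

-- Two orthogonal rows disagree in exactly half of the columns; `minus` marks these columns for the
-- first two rows.
hadamard-even : ∀ {m} {H : Matrix ℤ (suc (suc m))} → IsHadamard (suc (suc m)) H → 2 ∣ suc (suc m)
hadamard-even {m} {H} hadamard = divides (sumℕ minus) (ℤ.+-injective (begin
  + order
    ≡⟨ trans (∑ℤ-const order 1ℤ) (ℤ.*-identityʳ (+ order)) ⟨
  sumℤ {order} (λ _ → 1ℤ)
    ≡⟨ ∑ℤ-cong {order} (λ a → split (sign-* (entries 0F a) (entries 1F a))) ⟨
  sumℤ (λ a → + minus a ℤ.* + 2 ℤ.+ H 0F a ℤ.* H 1F a)
    ≡⟨ ∑ℤ-+ (λ a → + minus a ℤ.* + 2) (λ a → H 0F a ℤ.* H 1F a) ⟩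
  sumℤ (λ a → + minus a ℤ.* + 2) ℤ.+ sumℤ (λ a → H 0F a ℤ.* H 1F a)
    ≡⟨ cong₂ ℤ._+_ (sym (∑ℤ-* (+ 2) (λ a → + minus a))) (rows 0F 1F λ ()) ⟩
  sumℤ (λ a → + minus a) ℤ.* + 2 ℤ.+ 0ℤ
    ≡⟨ ℤ.+-identityʳ _ ⟩
  sumℤ (λ a → + minus a) ℤ.* + 2
    ≡⟨ cong (ℤ._* + 2) (+-∑ minus) ⟨
  + sumℕ minus ℤ.* + 2
    ≡⟨ ℤ.pos-* (sumℕ minus) 2 ⟨
  + (sumℕ minus * 2) ∎))
  where
  open ≡-Reasoning
  open IsHadamard hadamard
  order = suc (suc m)
  minus : Fin order → ℕ
  minus a = toℕ (bit (H 0F a ℤ.* H 1F a))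
  split : ∀ {x} → IsSign x → + toℕ (bit x) ℤ.* + 2 ℤ.+ x ≡ 1ℤ
  split (inj₁ refl) = refl
  split (inj₂ refl) = refl

-- After scaling, row 0 is constantly 1, so all other rows have sum 0.
normalised-layer-sum : ∀ {m} {H : Matrix ℤ (suc m)} → IsHadamard (suc m) H →
  let h = λ p a → H p a ℤ.* H zero a in
  ∀ a → sumℤ (λ p → h p a ℤ.* (sumℤ (h p) ℤ.* sumℤ (h p))) ≡ + (suc m * suc m)
normalised-layer-sum {m} {H} hadamard a = begin
  sumℤ (λ p → h p a ℤ.* (r p ℤ.* r p)) ≡⟨ ∑ℤ-single zero (λ p → h p a ℤ.* (r p ℤ.* r p)) others ⟩
  h zero a ℤ.* (r zero ℤ.* r zero)     ≡⟨ cong₂ (λ x y → x ℤ.* (y ℤ.* y)) (sign² (entries zero a)) (norm² (entries zero)) ⟩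
  1ℤ ℤ.* (+ suc m ℤ.* + suc m)         ≡⟨ ℤ.*-identityˡ (+ suc m ℤ.* + suc m) ⟩
  + suc m ℤ.* + suc m                  ≡⟨ ℤ.pos-* (suc m) (suc m) ⟨
  + (suc m * suc m)                    ∎
  where
  open ≡-Reasoning
  open IsHadamard hadamard
  h : Matrix ℤ (suc m)
  h p a = H p a ℤ.* H zero a
  r : Fin (suc m) → ℤ
  r p = sumℤ (h p)
  others : ∀ p → zero ≢ p → h p a ℤ.* (r p ℤ.* r p) ≡ 0ℤ
  others p 0≢p = trans (cong (λ x → h p a ℤ.* (x ℤ.* x)) (rows p zero (0≢p ∘ sym))) (ℤ.*-zeroʳ (h p a))

-- Column 0 is paired with the vector of row sums, which is constantly `s`; expanded by columns,
-- orthogonality leaves the norm of column 0.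
regular-sum² : ∀ {m s} {H : Matrix ℤ (suc m)} → IsHadamard (suc m) H →
  (∀ i → sumℤ (λ j → H i j) ≡ s) → (∀ j → sumℤ (λ i → H i j) ≡ s) → s ℤ.* s ≡ + suc m
regular-sum² {m} {s} {H} hadamard row-sum column-sum = begin
  s ℤ.* s                                              ≡⟨ cong (ℤ._* s) (column-sum zero) ⟨
  sumℤ (λ i → H i zero) ℤ.* s                          ≡⟨ ∑ℤ-* s (λ i → H i zero) ⟩
  sumℤ (λ i → H i zero ℤ.* s)                          ≡⟨ ∑ℤ-cong (λ i → cong (H i zero ℤ.*_) (row-sum i)) ⟨
  sumℤ (λ i → H i zero ℤ.* sumℤ (λ j → H i j))         ≡⟨ ∑ℤ-cong (λ i → *-∑ℤ (H i zero) (H i)) ⟩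
  sumℤ (λ i → sumℤ λ j → H i zero ℤ.* H i j)           ≡⟨ ∑ℤ-comm (λ i j → H i zero ℤ.* H i j) ⟩
  sumℤ (λ j → sumℤ λ i → H i zero ℤ.* H i j)           ≡⟨ ∑ℤ-single zero (λ j → sumℤ λ i → H i zero ℤ.* H i j) (columns zero) ⟩
  sumℤ (λ i → H i zero ℤ.* H i zero)                   ≡⟨ norm² (λ i → entries i zero) ⟩
  + suc m                                              ∎
  where
  open ≡-Reasoning
  open IsHadamard hadamard

square-injective : ∀ {x y} → x * x ≡ y * y → x ≡ y
square-injective {x} {y} eq with ℕ.<-cmp x y
... | tri< x<y _ _ = contradiction eq (ℕ.<⇒≢ (ℕ.*-mono-< x<y x<y))
... | tri≈ _ x≡y _ = x≡y
... | tri> _ _ y<x = contradiction (sym eq) (ℕ.<⇒≢ (ℕ.*-mono-< y<x y<x))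

-- The line sum of a regular matrix may be negative; scaling the matrix by the sign `u` makes it
-- `v`.
square-root : ∀ v s → s ℤ.* s ≡ + (v * v) → ∃[ u ] IsSign u × s ℤ.* u ≡ + v
square-root v (+ x) s²≡v² = 1ℤ , inj₁ refl , trans (ℤ.*-identityʳ (+ x))
  (cong +_ (square-injective (ℤ.+-injective (trans (ℤ.pos-* x x) s²≡v²))))
square-root v -[1+ x ] s²≡v² = -1ℤ , inj₂ refl ,
  cong +_ (trans (ℕ.*-identityʳ (suc x)) (square-injective (ℤ.+-injective s²≡v²)))

scaled-layer-sum : ∀ {s u} {H : Matrix ℤ n} → (∀ i → sumℤ (λ j → H i j) ≡ s) → (∀ j → sumℤ (λ i → H i j) ≡ s) →
  s ℤ.* u ≡ + v → let h = λ p a → H p a ℤ.* u in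
  ∀ a → sumℤ (λ p → h p a ℤ.* (sumℤ (h p) ℤ.* sumℤ (h p))) ≡ + (v ^ 3)
scaled-layer-sum {n} {v} {s} {u} {H} row-sum column-sum su≡v a = begin
  sumℤ (λ p → h p a ℤ.* (sumℤ (h p) ℤ.* sumℤ (h p)))
    ≡⟨ ∑ℤ-cong {n} (λ p → cong (λ x → h p a ℤ.* (x ℤ.* x)) (scaled (H p) (row-sum p))) ⟩
  sumℤ (λ p → h p a ℤ.* (+ v ℤ.* + v))
    ≡⟨ ∑ℤ-* (+ v ℤ.* + v) (λ p → h p a) ⟨
  sumℤ (λ p → h p a) ℤ.* (+ v ℤ.* + v)
    ≡⟨ cong₂ ℤ._*_ (scaled (λ p → H p a) (column-sum a)) (sym (ℤ.pos-* v v)) ⟩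
  + v ℤ.* + (v * v)
    ≡⟨ ℤ.pos-* v (v * v) ⟨
  + (v * (v * v))
    ≡⟨ cong (λ x → + (v * (v * x))) (ℕ.*-identityʳ v) ⟨
  + (v ^ 3) ∎
  where
  open ≡-Reasoning
  h : Matrix ℤ n
  h p a = H p a ℤ.* u
  scaled : (f : Fin n → ℤ) → sumℤ f ≡ s → sumℤ (λ i → f i ℤ.* u) ≡ + v
  scaled f ∑f≡s = trans (sym (∑ℤ-* u f)) (trans (cong (ℤ._* u) ∑f≡s) su≡v)

^-2 : ∀ v → v ^ 2 ≡ v * v
^-2 v = cong (v *_) (ℕ.*-identityʳ v)

labelling : ∀ v {H : Matrix ℤ (v ^ 2)} → 1 < v → (v % 3 ≡ 0 ⊎ v % 3 ≡ 2) → IsHadamard (v ^ 2) H → LatinLabelling v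
labelling (suc zero) (s≤s ()) _ _
labelling v@(suc (suc v′)) _ residue hadamard =
  -- As `v` is at least 2, the matrix has two rows, so v² is even, and then so is `v` because 2 is
  -- prime.
  from (Sum.reduce (euclidsLemma v v prime[2] (subst (2 ∣_) (^-2 v) (hadamard-even hadamard)))) residue
  where
  v≡ : ∀ {r} → v % 3 ≡ r → v ≡ r + (v / 3) * 3
  v≡ eq = trans (m≡m%n+[m/n]*n v 3) (cong (_+ (v / 3) * 3) eq)
  from : 2 ∣ v → v % 3 ≡ 0 ⊎ v % 3 ≡ 2 → LatinLabelling v
  from (divides u v≡2u) (inj₁ v≡0) = labelling-3∣v v′ (v / 3) u (v≡ v≡0) v≡2u
  -- Here v + 1 is three times `suc (v / 3)`.
  from (divides u v≡2u) (inj₂ v≡2) = labelling-3∣v+1 (suc v′) (suc (v / 3)) u (cong suc (v≡ v≡2)) v≡2u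

corollary4p13 : ∀ (v : ℕ) → 0 < v → (v % 3 ≡ 0 ⊎ v % 3 ≡ 2) → v ≢ 3 →
    ∀ (H : Matrix ℤ (v ^ 2)) → IsHadamard (v ^ 2) H →
    BlockSymmetricCube v (v ^ 4 * (v ^ 2 ∸ 1) / 2) (v ^ 4 * (v ^ 2 ∸ 2) / 4) ×
    (IsRegular H →
    BlockSymmetricCube v (v ^ 3 * (v ^ 3 ∸ 1) / 2) (v ^ 3 * (v ^ 3 ∸ 2) / 4))
corollary4p13 (suc zero) _ (inj₁ ()) _ H hadamard
corollary4p13 (suc zero) _ (inj₂ ()) _ H hadamard
corollary4p13 v@(suc (suc v′)) _ residue _ H hadamard = part-i , part-ii
  where
  open IsHadamard hadamard
  L : LatinLabelling v
  L = labelling v (s≤s (s≤s z≤n)) residue hadamard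

  part-i : BlockSymmetricCube v (v ^ 4 * (v ^ 2 ∸ 1) / 2) (v ^ 4 * (v ^ 2 ∸ 2) / 4)
  -- Column signs taken from row 0 make this row constantly 1. The layer sum is v⁴ and `t` is v²,
  -- with product v⁶.
  part-i = blockSymmetricCube L (λ p a → H p a ℤ.* H zero a)
    (scaleColumns (H zero) (entries zero) hadamard)
    (λ a → trans (normalised-layer-sum hadamard a) (cong +_ (sym (ℕ.^-distribˡ-+-* v 2 2))))
    (v ^ 2) (trans (sym (ℕ.^-distribˡ-+-* v 4 2)) (ℕ.^-distribˡ-+-* v 3 3))

  part-ii : IsRegular H → BlockSymmetricCube v (v ^ 3 * (v ^ 3 ∸ 1) / 2) (v ^ 3 * (v ^ 3 ∸ 2) / 4)
  part-ii (s , row-sum , column-sum) =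
    -- The line sum becomes `v` after scaling by `u`; the layer sum and `t` are then both v³.
    let u , u-sign , su≡v = square-root v s (trans (regular-sum² hadamard row-sum column-sum) (cong +_ (^-2 v)))
    in blockSymmetricCube L (λ p a → H p a ℤ.* u) (scaleColumns (λ _ → u) (λ _ → u-sign) hadamard)
         (scaled-layer-sum {H = H} row-sum column-sum su≡v) (v ^ 3) refl
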